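{- Let $R\ge 1$ be a fixed constant. There is an algorithm that, given an instance of $n$ keys whose weights all lie in the interval $[1,R]$, computes the cost of an optimal 2WCST for the instance in time $O(n^3)$ (where the constant in the $O$-notation may depend on $R$).
   Context: An instance consists of a linearly ordered set of $n$ keys, given in sorted order, each key $k$ having a weight $w_k$. A two-way comparison search tree (2WCST) is a rooted binary decision tree whose leaves are in bijection with the keys and in which each internal node is labelled either with an equal-to test $\langle =k\rangle$ ("is $q=k$?") or a less-than test $\langle <k\rangle$ ("is $q<k$?") for a key $k$, and has two children, one for "yes" and one for "no". It is required that for each key $q$, the search for $q$ starting at the root ends in the leaf labelled $q$. Its cost is $\sum_k w_k\cdot\mathrm{depth}(k)$, where $\mathrm{depth}(k)$ is the number of comparison nodes on the path from the root to leaf $k$; an optimal 2WCST is one of minimum cost. Time is measured in the unit-cost model (arithmetic operations and comparisons on weights take constant time). -}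

module Defs where

open import Level using (suc; _⊔_)
open import Algebra.Bundles using (CommutativeRing)
import Algebra.Properties.Monoid.Mult as Mult
import Algebra.Properties.Monoid.Sum as Sum
open import Data.Bool.Base using (Bool; true; false; if_then_else_)
open import Data.Fin.Base using (Fin; fromℕ<)
import Data.Fin.Properties as Fin
open import Data.Nat.Base as ℕ using (ℕ)
import Data.Nat.Properties as ℕ
open import Data.Product.Base using (∃-syntax; _×_; _,_; proj₁; proj₂)
open import Function.Definitions using (Bijective)
open import Relation.Binary.Core using (Rel)
open import Relation.Binary.PropositionalEquality.Core using (_≡_)
open import Relation.Binary.Structures using (IsDecTotalOrder)
open import Relation.Nullary using (¬_; yes; no; does)

-- The weights are real numbers.  As the standard library has no reals, weights
-- are taken from an arbitrary Archimedean ordered field; classically these are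
-- exactly the subfields of ℝ, ℝ itself included.  Decidability of the order is
-- part of the structure, since comparing two weights is a primitive operation
-- of the unit-cost model.
record ArchimedeanOrderedField c ℓ₁ ℓ₂ : Set (suc (c ⊔ ℓ₁ ⊔ ℓ₂)) where
  infix 4 _≤_
  field
    commutativeRing : CommutativeRing c ℓ₁
  open CommutativeRing commutativeRing public
  open Mult +-monoid public using () renaming (_×_ to _·_)
  open Sum +-monoid public using (sum)
  field
    0≉1             : ¬ 0# ≈ 1#
    invertible      : ∀ x → ¬ x ≈ 0# → ∃[ y ] x * y ≈ 1#
    _≤_             : Rel Carrier ℓ₂
    isDecTotalOrder : IsDecTotalOrder _≈_ _≤_
    +-monoˡ-≤       : ∀ z {x y} → x ≤ y → x + z ≤ y + z
    *-nonneg        : ∀ {x y} → 0# ≤ x → 0# ≤ y → 0# ≤ x * y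
    archimedean     : ∀ x → ∃[ n ] x ≤ n · 1#
  open IsDecTotalOrder isDecTotalOrder public using (_≟_; _≤?_)

  -- x ÷ 0 is 0 by convention.
  infixl 7 _÷_
  _÷_ : Carrier → Carrier → Carrier
  x ÷ y with y ≟ 0#
  ... | yes _   = 0#
  ... | no y≉0 = x * proj₁ (invertible y y≉0)

-- The n keys, in sorted order, are the elements of Fin n.
data Test (n : ℕ) : Set where
  equal-to  : Fin n → Test n
  less-than : Fin n → Test n

answer : ∀ {n} → Test n → Fin n → Bool
answer (equal-to k)  q = does (q Fin.≟ k)
answer (less-than k) q = does (q Fin.<? k)

data Tree (n : ℕ) : Set where
  leaf : Fin n → Tree n
  node : Test n → (yes-child no-child : Tree n) → Tree n

-- Positions of the leaves of a tree, i.e. the paths from the root to a leaf.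
data Leaf {n : ℕ} : Tree n → Set where
  here   : ∀ {k} → Leaf (leaf k)
  in-yes : ∀ {t y z} → Leaf y → Leaf (node t y z)
  in-no  : ∀ {t y z} → Leaf z → Leaf (node t y z)

label : ∀ {n} (T : Tree n) → Leaf T → Fin n
label (leaf k)     here       = k
label (node _ y z) (in-yes l) = label y l
label (node _ y z) (in-no l)  = label z l

leafDepth : ∀ {n} {T : Tree n} → Leaf T → ℕ
leafDepth here       = 0
leafDepth (in-yes l) = ℕ.suc (leafDepth l)
leafDepth (in-no l)  = ℕ.suc (leafDepth l)

search : ∀ {n} (T : Tree n) → Fin n → Leaf T
search (leaf k)     q = here
search (node t y z) q with answer t q
... | true  = in-yes (search y q)
... | false = in-no (search z q)

record 2WCST (n : ℕ) : Set where
  field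
    tree            : Tree n
    label-bijective : Bijective _≡_ _≡_ (label tree)
    search-correct  : ∀ q → label tree (search tree q) ≡ q

  leafOf : Fin n → Leaf tree
  leafOf k = proj₁ (proj₂ label-bijective k)

  depth : Fin n → ℕ
  depth k = leafDepth (leafOf k)

module _ {c ℓ₁ ℓ₂} (F : ArchimedeanOrderedField c ℓ₁ ℓ₂) where
  open ArchimedeanOrderedField F

  cost : ∀ {n} → (Fin n → Carrier) → 2WCST n → Carrier
  cost w T = sum (λ k → 2WCST.depth T k · w k)

  IsOptimalCost : ∀ {n} → (Fin n → Carrier) → Carrier → Set (ℓ₁ ⊔ ℓ₂)
  IsOptimalCost w v = (∃[ T ] cost w T ≈ v) × (∀ T → v ≤ cost w T)

-- The unit-cost model: a random access machine, given by structured programs,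
-- with one memory of natural numbers (indices) and one memory of weights, both
-- addressed indirectly by computed indices.  Indices have no multiplication or
-- bit operations, so that large indices cannot be used to do more than a
-- constant amount of work in one step, and there is no conversion of weights
-- to indices other than by branching on a comparison of weights.
data IndexExp : Set where
  const     : ℕ → IndexExp
  load      : IndexExp → IndexExp
  _+ᴵ_ _∸ᴵ_ : IndexExp → IndexExp → IndexExp

data WeightExp {c} (W : Set c) : Set c where
  const               : W → WeightExp W
  load                : IndexExp → WeightExp W
  _+ᵂ_ _-ᵂ_ _*ᵂ_ _÷ᵂ_ : WeightExp W → WeightExp W → WeightExp W

data Condition {c} (W : Set c) : Set c where
  _≤ᴵ_ : IndexExp → IndexExp → Condition W
  _≤ᵂ_ : WeightExp W → WeightExp W → Condition W

data Program {c} (W : Set c) : Set c where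
  skip           : Program W
  storeIndex     : (address value : IndexExp) → Program W
  storeWeight    : (address : IndexExp) (value : WeightExp W) → Program W
  _⨾_            : Program W → Program W → Program W
  ifᶜ_then_else_ : Condition W → Program W → Program W → Program W
  while_loop_    : Condition W → Program W → Program W

infixl 6 _+ᴵ_ _∸ᴵ_ _+ᵂ_ _-ᵂ_
infixl 7 _*ᵂ_ _÷ᵂ_
infix  4 _≤ᴵ_ _≤ᵂ_
infixr 2 _⨾_
infix  3 ifᶜ_then_else_ while_loop_

-- Each constant, memory access, arithmetic operation and comparison takes one
-- step.
indexTime : IndexExp → ℕ
indexTime (const _) = 1
indexTime (load a)  = 1 ℕ.+ indexTime a
indexTime (d +ᴵ e)  = 1 ℕ.+ indexTime d ℕ.+ indexTime e
indexTime (d ∸ᴵ e)  = 1 ℕ.+ indexTime d ℕ.+ indexTime e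

module _ {c} {W : Set c} where

  weightTime : WeightExp W → ℕ
  weightTime (const _) = 1
  weightTime (load a)  = 1 ℕ.+ indexTime a
  weightTime (d +ᵂ e)  = 1 ℕ.+ weightTime d ℕ.+ weightTime e
  weightTime (d -ᵂ e)  = 1 ℕ.+ weightTime d ℕ.+ weightTime e
  weightTime (d *ᵂ e)  = 1 ℕ.+ weightTime d ℕ.+ weightTime e
  weightTime (d ÷ᵂ e)  = 1 ℕ.+ weightTime d ℕ.+ weightTime e

  conditionTime : Condition W → ℕ
  conditionTime (d ≤ᴵ e) = 1 ℕ.+ indexTime d ℕ.+ indexTime e
  conditionTime (d ≤ᵂ e) = 1 ℕ.+ weightTime d ℕ.+ weightTime e

record State {c} (W : Set c) : Set c where
  constructor state
  field
    indices : ℕ → ℕ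
    weights : ℕ → W

_[_≔_] : ∀ {a} {A : Set a} → (ℕ → A) → ℕ → A → (ℕ → A)
(m [ i ≔ x ]) j = if does (j ℕ.≟ i) then x else m j

evalIndex : (ℕ → ℕ) → IndexExp → ℕ
evalIndex m (const n) = n
evalIndex m (load a)  = m (evalIndex m a)
evalIndex m (d +ᴵ e)  = evalIndex m d ℕ.+ evalIndex m e
evalIndex m (d ∸ᴵ e)  = evalIndex m d ℕ.∸ evalIndex m e

module _ {c ℓ₁ ℓ₂} (F : ArchimedeanOrderedField c ℓ₁ ℓ₂) where
  private module F = ArchimedeanOrderedField F
  open State

  evalWeight : State F.Carrier → WeightExp F.Carrier → F.Carrier
  evalWeight σ (const x) = x
  evalWeight σ (load a)  = weights σ (evalIndex (indices σ) a)
  evalWeight σ (d +ᵂ e)  = evalWeight σ d F.+ evalWeight σ e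
  evalWeight σ (d -ᵂ e)  = evalWeight σ d F.- evalWeight σ e
  evalWeight σ (d *ᵂ e)  = evalWeight σ d F.* evalWeight σ e
  evalWeight σ (d ÷ᵂ e)  = evalWeight σ d F.÷ evalWeight σ e

  evalCondition : State F.Carrier → Condition F.Carrier → Bool
  evalCondition σ (d ≤ᴵ e) = does (evalIndex (indices σ) d ℕ.≤? evalIndex (indices σ) e)
  evalCondition σ (d ≤ᵂ e) = does (evalWeight σ d F.≤? evalWeight σ e)

  -- Runs P σ t τ: started in state σ, P halts in state τ after t steps.
  data Runs : Program F.Carrier → State F.Carrier → ℕ → State F.Carrier → Set c where
    skip : ∀ {σ} → Runs skip σ 1 σ
    storeIndex : ∀ {a e σ} →
      Runs (storeIndex a e) σ (1 ℕ.+ indexTime a ℕ.+ indexTime e)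
        (state (indices σ [ evalIndex (indices σ) a ≔ evalIndex (indices σ) e ]) (weights σ))
    storeWeight : ∀ {a e σ} →
      Runs (storeWeight a e) σ (1 ℕ.+ indexTime a ℕ.+ weightTime e)
        (state (indices σ) (weights σ [ evalIndex (indices σ) a ≔ evalWeight σ e ]))
    seq : ∀ {P Q ρ σ τ s t} →
      Runs P ρ s σ → Runs Q σ t τ → Runs (P ⨾ Q) ρ (s ℕ.+ t) τ
    if-true : ∀ {b P Q σ τ t} → evalCondition σ b ≡ true →
      Runs P σ t τ → Runs (ifᶜ b then P else Q) σ (conditionTime b ℕ.+ t) τ
    if-false : ∀ {b P Q σ τ t} → evalCondition σ b ≡ false →
      Runs Q σ t τ → Runs (ifᶜ b then P else Q) σ (conditionTime b ℕ.+ t) τ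
    while-true : ∀ {b P ρ σ τ s t} → evalCondition ρ b ≡ true →
      Runs P ρ s σ → Runs (while b loop P) σ t τ →
      Runs (while b loop P) ρ (conditionTime b ℕ.+ s ℕ.+ t) τ
    while-false : ∀ {b P σ} → evalCondition σ b ≡ false →
      Runs (while b loop P) σ (conditionTime b) σ

  inputWeights : ∀ {n} → (Fin n → F.Carrier) → ℕ → F.Carrier
  inputWeights {n} w a with a ℕ.<? n
  ... | yes a<n = w (fromℕ< a<n)
  ... | no _    = F.0#

  -- Input: n in index cell 0 and the weights, in key order, in weight cells
  -- 0, …, n - 1; all other cells are 0.
  inputState : ∀ {n} → (Fin n → F.Carrier) → State F.Carrier
  inputState {n} w = state ((λ _ → 0) [ 0 ≔ n ]) (inputWeights w)

  output : State F.Carrier → F.Carrier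
  output σ = weights σ 0

  -- P halts on input w within T steps, with output the optimal cost.
  ComputesOptimalCost : ∀ {n} → Program F.Carrier → (Fin n → F.Carrier) → ℕ → Set (c ⊔ ℓ₁ ⊔ ℓ₂)
  ComputesOptimalCost P w T =
    ∃[ τ ] ∃[ t ] Runs P (inputState w) t τ × t ℕ.≤ T × IsOptimalCost F w (output τ)

{-# OPTIONS --safe #-}

-- Every test of a tree splits the keys that reach it by removing one key or by cutting the
-- sorted list, and a tree costs the total weight of the keys reaching its nodes.
--
-- If the total weight of a list of keys with weights in [1 , R] is at least 9R, the root of
-- an optimal tree may be taken to be a less-than test.  Suppose that the root is an equal-to
-- test.  If the next test is a less-than test whose side not containing the removed key is at
-- least as heavy as that key, it can be moved to the root.  Otherwise the first two tests each
-- split off a part of weight at most R, leaving a tree on a list of weight at least 7R.  Cut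
-- that list at its weighted median by a new root and restrict the old tree to both sides:
-- every old test becomes superfluous on one of the two sides, and the savings at the first
-- three nodes make up for the new root.
--
-- Hence, with K ≥ 9R, an interval of more than K keys is optimally cut into two intervals,
-- which gives the usual cubic dynamic program, and an interval of at most K keys is solved in
-- constant time by comparing the costs of all trees on it.

module Submission where

open import Defs
import Algebra.Properties.AbelianGroup as AbelianGroupProperties
import Algebra.Properties.Monoid.Sum as SumProperties
import Algebra.Properties.Ring as RingProperties
import Algebra.Solver.CommutativeMonoid as CommutativeMonoidSolver
open import Data.Bool.Base using (true; false)
open import Data.Empty using (⊥-elim)
open import Data.Fin.Base as Fin using (Fin)
import Data.Fin.Properties as Fin
open import Data.List.Base using (List; []; _∷_; _++_; map; length; allFin; tabulate; concatMap; cartesianProductWith)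
open import Data.List.Membership.DecPropositional using (_∈?_)
open import Data.List.Membership.Propositional using (_∈_; find; lose)
open import Data.List.Membership.Propositional.Properties using (∈-∃++; ∈-insert; ∈-++⁺ˡ; ∈-++⁺ʳ; ∈-++⁻; ∈-allFin; ∈-map⁺; ∈-map⁻; ∈-concatMap⁺; ∈-concatMap⁻; ∈-cartesianProductWith⁺; ∈-cartesianProductWith⁻)
open import Data.List.Properties using (++-assoc; ++-identityʳ; map-++; map-tabulate; length-++; length-++-sucʳ; ∷-injective; ++-conicalˡ; ++-conicalʳ)
open import Data.List.Relation.Unary.All as All using (All; []; _∷_)
import Data.List.Relation.Unary.All.Properties as All
open import Data.List.Relation.Unary.AllPairs using (AllPairs; []; _∷_)
import Data.List.Relation.Unary.AllPairs.Properties as AllPairs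
open import Data.List.Relation.Unary.Any using (here; there)
open import Data.Nat.Base as ℕ using (ℕ; zero; suc; _^_)
import Data.Nat.Properties as ℕ
open import Data.Product.Base using (Σ-syntax; ∃-syntax; _×_; _,_; proj₁; proj₂)
open import Data.Sum.Base using (_⊎_; inj₁; inj₂)
open import Function.Base using (_∘_; case_of_)
open import Level using (Level; _⊔_)
open import Relation.Binary.Bundles using (Poset)
open import Relation.Binary.PropositionalEquality as ≡ using (_≡_; _≢_)
import Relation.Binary.Reasoning.PartialOrder as PartialOrderReasoning
open import Relation.Binary.Structures using (IsDecTotalOrder)
open import Relation.Nullary using (¬_; Dec; yes; no; does)
open import Relation.Nullary.Decidable using (dec-true; dec-false)

-- The obstacle is that equal-to tests destroy intervals: after several of them the remaining keys
-- form an interval with holes, and there are far too many such sets for a cubic table.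
--
-- Origin of 9R: the new root costs the weight of the whole list. If the cut halved the keys below
-- the first two tests exactly, those two tests would save about that much. What they may fall short
-- by is the imbalance of the cut, at most R, and the two parts split off, at most R each. So the
-- third test has to save up to 3R, and what it saves is the weight of one side of the cut. Keys of
-- weight at least 7R, cut into sides that differ by at most R, leave at least 3R on each side.

private variable
  a b : Level
  A B : Set a

-- Compares the place of a cut with the place of a test in the same list; `ms` is the segment
-- between the two.
++-crossing : ∀ (as bs xs ys : List A) → as ++ bs ≡ xs ++ ys →
  (∃[ ms ] as ≡ xs ++ ms × ys ≡ ms ++ bs) ⊎ (∃[ ms ] xs ≡ as ++ ms × bs ≡ ms ++ ys)
++-crossing as       bs []       ys eq = inj₁ (as , ≡.refl , ≡.sym eq)
++-crossing []       bs (x ∷ xs) ys eq = inj₂ (x ∷ xs , ≡.refl , eq)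
++-crossing (a ∷ as) bs (x ∷ xs) ys eq with ≡.refl , eq′ ← ∷-injective eq with ++-crossing as bs xs ys eq′
... | inj₁ (ms , p , q) = inj₁ (ms , ≡.cong (a ∷_) p , q)
... | inj₂ (ms , p , q) = inj₂ (ms , ≡.cong (a ∷_) p , q)

-- Arithmetic in ordered fields

module OrderedField {c ℓ₁ ℓ₂} (F : ArchimedeanOrderedField c ℓ₁ ℓ₂) where
  open ArchimedeanOrderedField F public
  open IsDecTotalOrder isDecTotalOrder public using (isPartialOrder)
    renaming (refl to ≤-refl; trans to ≤-trans; reflexive to ≤-reflexive; total to ≤-total;
              antisym to ≤-antisym)
  open AbelianGroupProperties +-abelianGroup using (xyx⁻¹≈y; ⁻¹-involutive) public
  open RingProperties ring using (-1*x≈-x)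
  open CommutativeMonoidSolver +-commutativeMonoid public using (solve; _⊜_; _⊕_; id)

  poset : Poset c ℓ₁ ℓ₂
  poset = record { isPartialOrder = isPartialOrder }

  module ≤-Reasoning = PartialOrderReasoning poset

  cancel : ∀ x y → x + (y - x) ≈ y
  cancel x y = trans (sym (+-assoc x y (- x))) (xyx⁻¹≈y x y)

  -- The hypotheses say p ≤ q and b − a = q − p.
  ≤-by-difference : ∀ {p q a b} → p ≤ q → a + q ≈ b + p → a ≤ b
  ≤-by-difference {p} {q} {a} {b} p≤q eq = begin
    a              ≈⟨ cancel p a ⟨
    p + (a - p)    ≤⟨ +-monoˡ-≤ (a - p) p≤q ⟩
    q + (a - p)    ≈⟨ solve 3 (λ q a m → q ⊕ (a ⊕ m) ⊜ (a ⊕ q) ⊕ m) refl q a (- p) ⟩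
    (a + q) - p    ≈⟨ +-congʳ eq ⟩
    (b + p) - p    ≈⟨ solve 3 (λ b p m → (b ⊕ p) ⊕ m ⊜ p ⊕ (b ⊕ m)) refl b p (- p) ⟩
    p + (b - p)    ≈⟨ cancel p b ⟩
    b              ∎
    where open ≤-Reasoning

  +-mono-≤ : ∀ {x y u v} → x ≤ y → u ≤ v → x + u ≤ y + v
  +-mono-≤ {x} {y} {u} {v} x≤y u≤v = begin
    x + u  ≤⟨ +-monoˡ-≤ u x≤y ⟩
    y + u  ≈⟨ +-comm y u ⟩
    u + y  ≤⟨ +-monoˡ-≤ y u≤v ⟩
    v + y  ≈⟨ +-comm v y ⟩
    y + v  ∎
    where open ≤-Reasoning

  +-monoʳ-≤ : ∀ x {u v} → u ≤ v → x + u ≤ x + v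
  +-monoʳ-≤ x = +-mono-≤ ≤-refl

  x≤x+y : ∀ x {y} → 0# ≤ y → x ≤ x + y
  x≤x+y x {y} 0≤y = ≤-by-difference 0≤y (sym (+-identityʳ (x + y)))

  ≰⇒≥ : ∀ {x y} → ¬ x ≤ y → y ≤ x
  ≰⇒≥ {x} {y} x≰y with ≤-total x y
  ... | inj₁ x≤y = ⊥-elim (x≰y x≤y)
  ... | inj₂ y≤x = y≤x

  0≤1 : 0# ≤ 1#
  0≤1 with ≤-total 0# 1#
  ... | inj₁ h = h
  ... | inj₂ 1≤0 = ≤-trans (*-nonneg 0≤-1 0≤-1)
      (≤-reflexive (trans (-1*x≈-x (- 1#)) (⁻¹-involutive 1#)))
    where
    0≤-1 : 0# ≤ - 1#
    0≤-1 = ≤-trans (≤-reflexive (sym (-‿inverseʳ 1#)))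
      (≤-trans (+-monoˡ-≤ (- 1#) 1≤0) (≤-reflexive (+-identityˡ (- 1#))))

  thrice : Carrier → Carrier
  thrice x = x + (x + x)

-- Decision trees on a list of weighted keys

module WeightedKeys {c ℓ₁ ℓ₂} (F : ArchimedeanOrderedField c ℓ₁ ℓ₂) where
  open OrderedField F

  module _ {a} {A : Set a} (wt : A → Carrier) where

    total : List A → Carrier
    total []       = 0#
    total (x ∷ xs) = wt x + total xs

    -- The cost of a node is charged as the total weight of the keys that reach it.
    data HasTree : List A → Carrier → Set (a ⊔ c ⊔ ℓ₁) where
      leaf  : ∀ {x v} → v ≈ 0# → HasTree (x ∷ []) v
      equal : ∀ {ks} xs x ys {v u} → ks ≡ xs ++ x ∷ ys →
              HasTree (xs ++ ys) u → v ≈ total ks + u → HasTree ks v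
      less  : ∀ {ks} xs ys {v u₁ u₂} → ks ≡ xs ++ ys →
              HasTree xs u₁ → HasTree ys u₂ → v ≈ total ks + (u₁ + u₂) → HasTree ks v

    IsOptimal : List A → Carrier → Set (a ⊔ c ⊔ ℓ₁ ⊔ ℓ₂)
    IsOptimal ks v = HasTree ks v × (∀ {u} → HasTree ks u → v ≤ u)

  module _ {a} {A : Set a} {wt : A → Carrier} where
    private W = total wt

    total-++ : ∀ xs ys → W (xs ++ ys) ≈ W xs + W ys
    total-++ []       ys = sym (+-identityˡ (W ys))
    total-++ (x ∷ xs) ys = trans (+-congˡ (total-++ xs ys)) (sym (+-assoc (wt x) (W xs) (W ys)))

    total-insert : ∀ xs x ys → W (xs ++ x ∷ ys) ≈ W (xs ++ ys) + wt x
    total-insert xs x ys = begin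
      W (xs ++ x ∷ ys)       ≈⟨ total-++ xs (x ∷ ys) ⟩
      W xs + (wt x + W ys)   ≈⟨ solve 3 (λ p q r → p ⊕ (q ⊕ r) ⊜ (p ⊕ r) ⊕ q) refl (W xs) (wt x) (W ys) ⟩
      (W xs + W ys) + wt x   ≈⟨ +-congʳ (total-++ xs ys) ⟨
      W (xs ++ ys) + wt x    ∎
      where open import Relation.Binary.Reasoning.Setoid setoid

    HasTree-resp-≈ : ∀ {ks u v} → u ≈ v → HasTree wt ks u → HasTree wt ks v
    HasTree-resp-≈ u≈v (leaf p)                  = leaf (trans (sym u≈v) p)
    HasTree-resp-≈ u≈v (equal xs x ys eq t p)    = equal xs x ys eq t (trans (sym u≈v) p)
    HasTree-resp-≈ u≈v (less xs ys eq t₁ t₂ p)   = less xs ys eq t₁ t₂ (trans (sym u≈v) p)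

    HasTree⇒≢[] : ∀ {ks v} → HasTree wt ks v → ks ≢ []
    HasTree⇒≢[] (less [] ys ≡.refl t _ _)  _ = HasTree⇒≢[] t ≡.refl
    HasTree⇒≢[] (equal [] x ys ≡.refl t _) ()
    HasTree⇒≢[] (equal (_ ∷ _) x ys ≡.refl t _) ()
    HasTree⇒≢[] (less (_ ∷ _) ys ≡.refl t _ _) ()
    HasTree⇒≢[] (leaf _) ()

    -- Restricting a tree to one side of a cut may leave no keys at all. Giving the empty list cost
    -- 0 lets the exchange arithmetic treat this case like any other.
    data HasTree? : List A → Carrier → Set (a ⊔ c ⊔ ℓ₁) where
      none : ∀ {v} → v ≈ 0# → HasTree? [] v
      some : ∀ {ks v} → HasTree wt ks v → HasTree? ks v

    -- Peel ks ks′ d u: the root of a tree on ks′ separates ks from a part of weight d for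
    -- which a tree of cost u is given.
    data Peel (ks : List A) : List A → Carrier → Carrier → Set (a ⊔ c ⊔ ℓ₁) where
      equal : ∀ xs x ys → ks ≡ xs ++ ys → Peel ks (xs ++ x ∷ ys) (wt x) 0#
      lessʳ : ∀ {ms u} → HasTree wt ms u → Peel ks (ks ++ ms) (W ms) u
      lessˡ : ∀ {ms u} → HasTree wt ms u → Peel ks (ms ++ ks) (W ms) u

    Peel-total : ∀ {ks ks′ d u} → Peel ks ks′ d u → W ks′ ≈ W ks + d
    Peel-total (equal xs x ys ≡.refl)      = total-insert xs x ys
    Peel-total {ks} (lessʳ {ms} _)         = total-++ ks ms
    Peel-total {ks} (lessˡ {ms} _)         = trans (total-++ ms ks) (+-comm (W ms) (W ks))

    module _ (wt-nonneg : ∀ x → 0# ≤ wt x) where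

      total-nonneg : ∀ xs → 0# ≤ W xs
      total-nonneg []       = ≤-refl
      total-nonneg (x ∷ xs) = ≤-trans (wt-nonneg x) (x≤x+y (wt x) (total-nonneg xs))

      -- The test is put back above the tree on `ks`. If `ks` is empty it separates nothing and is
      -- dropped, so that the tree on the part split off remains; nonnegative weights then give the
      -- bound.
      Peel-tree : ∀ {ks ks′ d e u} → Peel ks ks′ d e → HasTree? ks u →
        ∃[ v ] HasTree? ks′ v × v ≤ W ks′ + (u + e)
      Peel-tree {u = u} (equal xs x ys eq) (some t) =
        _ , some (equal xs x ys ≡.refl (≡.subst (λ ks → HasTree wt ks u) eq t) refl) ,
        +-monoʳ-≤ _ (≤-reflexive (sym (+-identityʳ u)))
      Peel-tree (lessʳ {ms} s) (some t) = _ , some (less _ ms ≡.refl t s refl) , ≤-refl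
      Peel-tree (lessˡ {ms} s) (some t) =
        _ , some (less ms _ ≡.refl s t refl) , +-monoʳ-≤ _ (≤-reflexive (+-comm _ _))
      Peel-tree {u = u} (equal [] x [] ≡.refl) (none u≈0) =
        0# , some (leaf refl) ,
        ≤-trans (total-nonneg (x ∷ [])) (x≤x+y _ (≤-reflexive (sym (trans (+-identityʳ u) u≈0))))
      Peel-tree {u = u} (lessʳ {ms} {e} s) (none u≈0) =
        e , some s , ≤-by-difference (total-nonneg ms)
          (trans (+-congˡ (sym (trans (+-congʳ u≈0) (+-identityˡ (W ms)))))
                 (solve 3 (λ e u w → e ⊕ (u ⊕ w) ⊜ (w ⊕ (u ⊕ e)) ⊕ id) refl e u (W ms)))
      Peel-tree {u = u} (lessˡ {ms} {e} s) (none u≈0) =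
        e , some (≡.subst (λ ks → HasTree wt ks e) (≡.sym (++-identityʳ ms)) s) ,
        ≤-by-difference (total-nonneg (ms ++ []))
          (trans (+-congˡ (sym (trans (+-congʳ u≈0) (+-identityˡ (W (ms ++ []))))))
                 (solve 3 (λ e u w → e ⊕ (u ⊕ w) ⊜ (w ⊕ (u ⊕ e)) ⊕ id) refl e u (W (ms ++ []))))

      -- Restricting a tree to both sides of a cut

      SplitTrees : List A → List A → Carrier → Set (a ⊔ c ⊔ ℓ₁ ⊔ ℓ₂)
      SplitTrees as bs v = ∃[ p ] ∃[ q ] HasTree? as p × HasTree? bs q × p + q ≤ v

      -- A root test that splits off keys on the left of the cut is put back on the left only. The
      -- keys of `bs` no longer meet it, which saves `W bs`.
      splitˡ : ∀ {as as′ bs d e u v μ} → Peel as as′ d e → v ≈ W (as′ ++ bs) + (u + e) →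
        μ ≤ W bs → SplitTrees as bs u → ∃[ p ] ∃[ q ] HasTree? as′ p × HasTree? bs q × (p + q) + μ ≤ v
      splitˡ {as} {as′} {bs} {d} {e} {u} {v} {μ} P v≈ μ≤ (p , q , tp , tq , p+q≤u)
        with p′ , tp′ , p′≤ ← Peel-tree P tp =
        p′ , q , tp′ , tq , (begin
          (p′ + q) + μ                        ≤⟨ +-mono-≤ (+-monoˡ-≤ q p′≤) μ≤ ⟩
          ((W as′ + (p + e)) + q) + W bs      ≈⟨ solve 5 (λ w p e q w′ → ((w ⊕ (p ⊕ e)) ⊕ q) ⊕ w′ ⊜ (w ⊕ w′) ⊕ ((p ⊕ q) ⊕ e))
                                                   refl (W as′) p e q (W bs) ⟩
          (W as′ + W bs) + ((p + q) + e)      ≤⟨ +-monoʳ-≤ _ (+-monoˡ-≤ e p+q≤u) ⟩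
          (W as′ + W bs) + (u + e)            ≈⟨ +-congʳ (total-++ as′ bs) ⟨
          W (as′ ++ bs) + (u + e)             ≈⟨ v≈ ⟨
          v                                   ∎)
        where open ≤-Reasoning

      splitʳ : ∀ {as bs bs′ d e u v μ} → Peel bs bs′ d e → v ≈ W (as ++ bs′) + (u + e) →
        μ ≤ W as → SplitTrees as bs u → ∃[ p ] ∃[ q ] HasTree? as p × HasTree? bs′ q × (p + q) + μ ≤ v
      splitʳ {as} {bs} {bs′} {d} {e} {u} {v} {μ} P v≈ μ≤ (p , q , tp , tq , p+q≤u)
        with q′ , tq′ , q′≤ ← Peel-tree P tq =
        p , q′ , tp , tq′ , (begin
          (p + q′) + μ                        ≤⟨ +-mono-≤ (+-monoʳ-≤ p q′≤) μ≤ ⟩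
          (p + (W bs′ + (q + e))) + W as      ≈⟨ solve 5 (λ w p e q w′ → (p ⊕ (w ⊕ (q ⊕ e))) ⊕ w′ ⊜ (w′ ⊕ w) ⊕ ((p ⊕ q) ⊕ e))
                                                   refl (W bs′) p e q (W as) ⟩
          (W as + W bs′) + ((p + q) + e)      ≤⟨ +-monoʳ-≤ _ (+-monoˡ-≤ e p+q≤u) ⟩
          (W as + W bs′) + (u + e)            ≈⟨ +-congʳ (total-++ as bs′) ⟨
          W (as ++ bs′) + (u + e)             ≈⟨ v≈ ⟨
          v                                   ∎)
        where open ≤-Reasoning

      -- The root test is needed on one side of the cut only, so the keys of the other side save it;
      -- which side that is depends on the tree, hence both bounds on `μ`. Savings deeper in the
      -- tree are given up: the recursion through `splitTrees` takes `μ` to be 0.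
      split : ∀ as bs {ks v μ} → HasTree wt ks v → ks ≡ as ++ bs → μ ≤ W as → μ ≤ W bs →
        ∃[ p ] ∃[ q ] HasTree? as p × HasTree? bs q × (p + q) + μ ≤ v

      splitTrees : ∀ as bs {ks v} → HasTree wt ks v → ks ≡ as ++ bs → SplitTrees as bs v
      splitTrees as bs t eq
        with p , q , tp , tq , h ← split as bs t eq (total-nonneg as) (total-nonneg bs) =
        p , q , tp , tq , ≤-trans (≤-reflexive (sym (+-identityʳ (p + q)))) h

      split [] (_ ∷ []) {v = v} {μ} (leaf v≈0) ≡.refl μ≤0 _ =
        0# , 0# , none refl , some (leaf refl) ,
        ≤-trans (+-monoʳ-≤ _ μ≤0) (≤-reflexive (trans (trans (+-identityʳ _) (+-identityʳ _)) (sym v≈0)))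
      split (_ ∷ []) [] {v = v} {μ} (leaf v≈0) ≡.refl _ μ≤0 =
        0# , 0# , some (leaf refl) , none refl ,
        ≤-trans (+-monoʳ-≤ _ μ≤0) (≤-reflexive (trans (trans (+-identityʳ _) (+-identityʳ _)) (sym v≈0)))
      split as bs (less xs ys eq t₁ t₂ v≈) ≡.refl μ≤a μ≤b with ++-crossing as bs xs ys eq
      ... | inj₁ (ms , ≡.refl , ≡.refl) =
        splitˡ (lessˡ t₁) (trans v≈ (+-congˡ (+-comm _ _))) μ≤b (splitTrees ms bs t₂ ≡.refl)
      ... | inj₂ (ms , ≡.refl , ≡.refl) = splitʳ (lessʳ t₂) v≈ μ≤a (splitTrees as ms t₁ ≡.refl)
      split as bs (equal xs x ys eq t v≈) ≡.refl μ≤a μ≤b with ++-crossing as bs xs (x ∷ ys) eq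
      ... | inj₁ (y ∷ ms , ≡.refl , ≡.refl) =
        splitˡ (equal xs x ms ≡.refl) (trans v≈ (+-congˡ (sym (+-identityʳ _)))) μ≤b
          (splitTrees (xs ++ ms) bs t (≡.sym (++-assoc xs ms bs)))
      ... | inj₁ ([] , ≡.refl , ≡.refl) =
        splitʳ (equal [] x ys ≡.refl) (trans v≈ (+-congˡ (sym (+-identityʳ _)))) μ≤a
          (splitTrees (xs ++ []) ys t (≡.cong (_++ ys) (≡.sym (++-identityʳ xs))))
      ... | inj₂ (ms , ≡.refl , ≡.refl) =
        splitʳ (equal ms x ys ≡.refl) (trans v≈ (+-congˡ (sym (+-identityʳ _)))) μ≤a
          (splitTrees as (ms ++ ys) t (++-assoc as ms ys))

      -- Exchanging the root for a less-than test

      LessRoot : List A → Carrier → Set (a ⊔ c ⊔ ℓ₁ ⊔ ℓ₂)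
      LessRoot ks v = ∃[ xs ] ∃[ ys ] ∃[ p ] ∃[ q ]
        ks ≡ xs ++ ys × HasTree wt xs p × HasTree wt ys q × W ks + (p + q) ≤ v

      -- A test splits off a single key or an end segment, so a cut of the remaining keys never runs
      -- through the part split off, which can join one side as a whole.
      Peel-extend : ∀ as bs {ks d e} → Peel (as ++ bs) ks d e →
        (∃[ as′ ] ks ≡ as′ ++ bs × Peel as as′ d e) ⊎ (∃[ bs′ ] ks ≡ as ++ bs′ × Peel bs bs′ d e)
      Peel-extend as bs (equal xs x ys eq) with ++-crossing as bs xs ys eq
      ... | inj₁ (ms , ≡.refl , ≡.refl) =
        inj₁ (xs ++ x ∷ ms , ≡.sym (++-assoc xs (x ∷ ms) bs) , equal xs x ms ≡.refl)
      ... | inj₂ (ms , ≡.refl , ≡.refl) =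
        inj₂ (ms ++ x ∷ ys , ++-assoc as ms (x ∷ ys) , equal ms x ys ≡.refl)
      Peel-extend as bs (lessʳ {ms} t) = inj₂ (bs ++ ms , ++-assoc as bs ms , lessʳ t)
      Peel-extend as bs (lessˡ {ms} t) = inj₁ (ms ++ as , ≡.sym (++-assoc ms as bs) , lessˡ t)

      Peel-mono : ∀ {ks ks′ d e} → Peel ks ks′ d e → W ks ≤ W ks′
      Peel-mono {ks} P = ≤-trans (x≤x+y (W ks) (d-nonneg P)) (≤-reflexive (sym (Peel-total P)))
        where
        d-nonneg : ∀ {ks ks′ d e} → Peel ks ks′ d e → 0# ≤ d
        d-nonneg (equal _ x _ _) = wt-nonneg x
        d-nonneg (lessʳ {ms} _)  = total-nonneg ms
        d-nonneg (lessˡ {ms} _)  = total-nonneg ms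

      heavy-tree : ∀ {ks v μ} → ¬ μ ≤ 0# → μ ≤ W ks → HasTree? ks v → HasTree wt ks v
      heavy-tree μ≰0 μ≤ (some t) = t
      heavy-tree μ≰0 μ≤ (none _) = ⊥-elim (μ≰0 μ≤)

      private
        -- Index 2 belongs to the root of the old tree, index 1 to the test below it; `α` is the
        -- weight of the side that keeps both tests. The other side saves `β` at each of them, and
        -- the third test saves `μ`. The new root costs `α + β + d₁ + d₂`, so the second hypothesis
        -- says exactly that `2β + μ` covers it.
        same-side : ∀ {α β d₁ d₂ e₁ e₂ w w₁ w₂ p p₁ p₂ q u μ} →
          (p + q) + μ ≤ u → α + (d₁ + d₂) ≤ β + μ →
          w₁ ≈ α + d₁ → w₂ ≈ w₁ + d₂ → w ≈ (α + β) + d₁ →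
          p₁ ≤ w₁ + (p + e₁) → p₂ ≤ w₂ + (p₁ + e₂) →
          p₂ + q ≤ (w + (u + e₁)) + e₂
        same-side {α} {β} {d₁} {d₂} {e₁} {e₂} {w} {w₁} {w₂} {p} {p₁} {p₂} {q} {u} {μ} h k w₁≈ w₂≈ w≈ p₁≤ p₂≤ = begin
          p₂ + q
            ≤⟨ +-monoˡ-≤ q (≤-trans p₂≤ (+-monoʳ-≤ w₂ (+-monoˡ-≤ e₂ p₁≤))) ⟩
          (w₂ + ((w₁ + (p + e₁)) + e₂)) + q
            ≈⟨ +-congʳ (+-cong (trans w₂≈ (+-congʳ w₁≈)) (+-congʳ (+-congʳ w₁≈))) ⟩
          (((α + d₁) + d₂) + (((α + d₁) + (p + e₁)) + e₂)) + q
            -- The inequalities used are added up into one, which leaves an identity without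
            -- subtraction for the commutative monoid solver.
            ≤⟨ ≤-by-difference (+-mono-≤ h k)
                 (solve 10 (λ α β d₁ d₂ e₁ e₂ p q u μ →
                    ((((α ⊕ d₁) ⊕ d₂) ⊕ (((α ⊕ d₁) ⊕ (p ⊕ e₁)) ⊕ e₂)) ⊕ q) ⊕ (u ⊕ (β ⊕ μ))
                      ⊜ ((((α ⊕ β) ⊕ d₁) ⊕ (u ⊕ e₁)) ⊕ e₂) ⊕ (((p ⊕ q) ⊕ μ) ⊕ (α ⊕ (d₁ ⊕ d₂))))
                    refl α β d₁ d₂ e₁ e₂ p q u μ) ⟩
          (((α + β) + d₁) + (u + e₁)) + e₂
            ≈⟨ +-congʳ (+-congʳ w≈) ⟨
          (w + (u + e₁)) + e₂  ∎
          where open ≤-Reasoning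

        -- The old root stays on the side of weight `β` and saves `α + d₁`; the test below it stays
        -- on the side of weight `α` and saves `β`. Of the price `α + β + d₁ + d₂` of the new root
        -- only `d₂` is left for the saving `μ` of the third test.
        opposite-sides : ∀ {α β d₁ d₂ e₁ e₂ w w₁ w₂ p p₁ q q₁ u μ} →
          (p + q) + μ ≤ u → d₂ ≤ μ →
          w₁ ≈ α + d₁ → w₂ ≈ β + d₂ → w ≈ (α + β) + d₁ →
          p₁ ≤ w₁ + (p + e₁) → q₁ ≤ w₂ + (q + e₂) →
          p₁ + q₁ ≤ (w + (u + e₁)) + e₂
        opposite-sides {α} {β} {d₁} {d₂} {e₁} {e₂} {w} {w₁} {w₂} {p} {p₁} {q} {q₁} {u} {μ} h k w₁≈ w₂≈ w≈ p₁≤ q₁≤ = begin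
          p₁ + q₁
            ≤⟨ +-mono-≤ p₁≤ q₁≤ ⟩
          (w₁ + (p + e₁)) + (w₂ + (q + e₂))
            ≈⟨ +-cong (+-congʳ w₁≈) (+-congʳ w₂≈) ⟩
          ((α + d₁) + (p + e₁)) + ((β + d₂) + (q + e₂))
            ≤⟨ ≤-by-difference (+-mono-≤ h k)
                 (solve 10 (λ α β d₁ d₂ e₁ e₂ p q u μ →
                    (((α ⊕ d₁) ⊕ (p ⊕ e₁)) ⊕ ((β ⊕ d₂) ⊕ (q ⊕ e₂))) ⊕ (u ⊕ μ)
                      ⊜ ((((α ⊕ β) ⊕ d₁) ⊕ (u ⊕ e₁)) ⊕ e₂) ⊕ (((p ⊕ q) ⊕ μ) ⊕ d₂))
                    refl α β d₁ d₂ e₁ e₂ p q u μ) ⟩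
          (((α + β) + d₁) + (u + e₁)) + e₂
            ≈⟨ +-congʳ (+-congʳ w≈) ⟨
          (w + (u + e₁)) + e₂  ∎
          where open ≤-Reasoning

      -- Each of the two tests at the top of the old tree is needed on only one side of the new
      -- root, so the keys on the other side save the comparison that the new root costs.
      cut-exchange : ∀ as bs {ks₁ ks d₁ e₁ d₂ e₂ u μ} →
        Peel (as ++ bs) ks₁ d₁ e₁ → Peel ks₁ ks d₂ e₂ → HasTree wt (as ++ bs) u →
        ¬ μ ≤ 0# → μ ≤ W as → μ ≤ W bs → d₂ ≤ μ →
        W as + (d₁ + d₂) ≤ W bs + μ → W bs + (d₁ + d₂) ≤ W as + μ →
        LessRoot ks (W ks + ((W ks₁ + (u + e₁)) + e₂))
      cut-exchange as bs P₁ P₂ t μ≰0 μ≤a μ≤b d₂≤μ a≤b b≤a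
        with w≈ ← trans (Peel-total P₁) (+-congʳ (total-++ as bs))
           | p , q , tp , tq , h ← split as bs t ≡.refl μ≤a μ≤b
        with Peel-extend as bs P₁
      ... | inj₁ (as₁ , ≡.refl , Q₁) with p₁ , tp₁ , p₁≤ ← Peel-tree Q₁ tp | Peel-extend as₁ bs P₂
      ...   | inj₁ (as₂ , ≡.refl , Q₂) with p₂ , tp₂ , p₂≤ ← Peel-tree Q₂ tp₁ =
        as₂ , bs , p₂ , q , ≡.refl ,
        heavy-tree μ≰0 (≤-trans μ≤a (≤-trans (Peel-mono Q₁) (Peel-mono Q₂))) tp₂ ,
        heavy-tree μ≰0 μ≤b tq ,
        +-monoʳ-≤ _ (same-side h a≤b (Peel-total Q₁) (Peel-total Q₂) w≈ p₁≤ p₂≤)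
      ...   | inj₂ (bs₂ , ≡.refl , Q₂) with q₂ , tq₂ , q₂≤ ← Peel-tree Q₂ tq =
        as₁ , bs₂ , p₁ , q₂ , ≡.refl ,
        heavy-tree μ≰0 (≤-trans μ≤a (Peel-mono Q₁)) tp₁ ,
        heavy-tree μ≰0 (≤-trans μ≤b (Peel-mono Q₂)) tq₂ ,
        +-monoʳ-≤ _ (opposite-sides h d₂≤μ (Peel-total Q₁) (Peel-total Q₂) w≈ p₁≤ q₂≤)
      cut-exchange as bs P₁ P₂ t μ≰0 μ≤a μ≤b d₂≤μ a≤b b≤a
          | inj₂ (bs₁ , ≡.refl , Q₁) with q₁ , tq₁ , q₁≤ ← Peel-tree Q₁ tq | Peel-extend as bs₁ P₂
      ...   | inj₁ (as₂ , ≡.refl , Q₂) with p₂ , tp₂ , p₂≤ ← Peel-tree Q₂ tp =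
        as₂ , bs₁ , p₂ , q₁ , ≡.refl ,
        heavy-tree μ≰0 (≤-trans μ≤a (Peel-mono Q₂)) tp₂ ,
        heavy-tree μ≰0 (≤-trans μ≤b (Peel-mono Q₁)) tq₁ ,
        +-monoʳ-≤ _ (≤-trans (≤-reflexive (+-comm p₂ q₁))
          (opposite-sides (≤-trans (+-monoˡ-≤ _ (≤-reflexive (+-comm q p))) h) d₂≤μ (Peel-total Q₁) (Peel-total Q₂)
            (trans w≈ (+-congʳ (+-comm (W as) (W bs)))) q₁≤ p₂≤))
      ...   | inj₂ (bs₂ , ≡.refl , Q₂) with q₂ , tq₂ , q₂≤ ← Peel-tree Q₂ tq₁ =
        as , bs₂ , p , q₂ , ≡.refl ,
        heavy-tree μ≰0 μ≤a tp ,
        heavy-tree μ≰0 (≤-trans μ≤b (≤-trans (Peel-mono Q₁) (Peel-mono Q₂))) tq₂ ,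
        +-monoʳ-≤ _ (≤-trans (≤-reflexive (+-comm p q₂))
          (same-side (≤-trans (+-monoˡ-≤ _ (≤-reflexive (+-comm q p))) h) b≤a (Peel-total Q₁) (Peel-total Q₂)
            (trans w≈ (+-congʳ (+-comm (W as) (W bs)))) q₁≤ q₂≤))

      -- Heavy lists of keys of weight at most R

      module _ (R : Carrier) (1≤R : 1# ≤ R) (wt≤R : ∀ x → wt x ≤ R) where
        private
          R≰0 : ¬ R ≤ 0#
          R≰0 R≤0 = 0≉1 (≤-antisym 0≤1 (≤-trans 1≤R R≤0))

          0≤R : 0# ≤ R
          0≤R = ≰⇒≥ R≰0

        private
          3R 9R : Carrier
          3R = thrice R
          9R = thrice 3R

          R≤3R : R ≤ 3R
          R≤3R = x≤x+y R (≤-trans 0≤R (x≤x+y R 0≤R))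

          3R≰0 : ¬ 3R ≤ 0#
          3R≰0 3R≤0 = R≰0 (≤-trans R≤3R 3R≤0)

          ¬light : ∀ {x} → x ≤ R + R → ¬ 9R ≤ x
          ¬light x≤2R 9R≤x = 3R≰0 (≤-trans (≤-by-difference
            (+-mono-≤ (≤-trans 9R≤x x≤2R) (+-mono-≤ 0≤R (+-mono-≤ 0≤R (+-mono-≤ 0≤R 0≤R))))
            (solve 1 (λ r → (r ⊕ (r ⊕ r)) ⊕ ((r ⊕ r) ⊕ (r ⊕ (r ⊕ (r ⊕ r))))
               ⊜ id ⊕ (((r ⊕ (r ⊕ r)) ⊕ ((r ⊕ (r ⊕ r)) ⊕ (r ⊕ (r ⊕ r)))) ⊕ (id ⊕ (id ⊕ (id ⊕ id))))) refl R))
            ≤-refl)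

        -- Keys move from `bs` to `as` one at a time. Each move changes the difference of the two
        -- weights by twice a key weight, hence by at most 2R, so the difference cannot jump over
        -- the window from -R to R.
        balanced-cut : ∀ as bs → W as ≤ W bs + R →
          ∃[ xs ] ∃[ ys ] as ++ bs ≡ xs ++ ys × W xs ≤ W ys + R × W ys ≤ W xs + R
        balanced-cut as [] h =
          as , [] , ≡.refl , h , ≤-trans (total-nonneg as) (x≤x+y (W as) 0≤R)
        balanced-cut as (x ∷ bs) h with W (x ∷ bs) ≤? W as + R
        ... | yes k = as , x ∷ bs , ≡.refl , h , k
        ... | no ¬k with xs , ys , eq , k ← balanced-cut (as ++ x ∷ []) bs
          (≤-trans (≤-reflexive (total-++ as (x ∷ []))) (≤-by-difference
            (+-mono-≤ (≰⇒≥ ¬k) (+-mono-≤ (wt≤R x) (wt≤R x)))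
            (solve 4 (λ a x b r → (a ⊕ (x ⊕ id)) ⊕ ((x ⊕ b) ⊕ (r ⊕ r)) ⊜ (b ⊕ r) ⊕ ((a ⊕ r) ⊕ (x ⊕ x)))
              refl (W as) (wt x) (W bs) R))) =
          xs , ys , ≡.trans (≡.sym (++-assoc as (x ∷ []) bs)) eq , k

        private
          heavy-half : ∀ {α β w d₁ d₂} → w ≈ (α + β) + (d₁ + d₂) → 9R ≤ w →
            d₁ ≤ R → d₂ ≤ R → β ≤ α + R → 3R ≤ α
          heavy-half {α} {β} {w} {d₁} {d₂} w≈ 9R≤w d₁≤ d₂≤ β≤ with 3R ≤? α
          ... | yes h = h
          -- The hypotheses only give 6R ≤ 2α. Bounding one of the two copies of `α` by 3R, as this
          -- case allows, avoids a division by 2.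
          ... | no ¬h = ≤-by-difference
            (+-mono-≤ (≤-trans 9R≤w (≤-reflexive w≈)) (+-mono-≤ (+-mono-≤ d₁≤ d₂≤) (+-mono-≤ β≤ (≰⇒≥ ¬h))))
            (solve 5 (λ α β d₁ d₂ r → let t = r ⊕ (r ⊕ r) in
               t ⊕ (((α ⊕ β) ⊕ (d₁ ⊕ d₂)) ⊕ ((r ⊕ r) ⊕ ((α ⊕ r) ⊕ t)))
                 ⊜ α ⊕ ((t ⊕ (t ⊕ t)) ⊕ ((d₁ ⊕ d₂) ⊕ (β ⊕ α))))
               refl α β d₁ d₂ R)

          near : ∀ {α β d₁ d₂} → α ≤ β + R → d₁ ≤ R → d₂ ≤ R → α + (d₁ + d₂) ≤ β + 3R
          near {α} {β} h d₁≤ d₂≤ = ≤-trans (+-mono-≤ h (+-mono-≤ d₁≤ d₂≤))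
            (≤-reflexive (+-assoc β R (R + R)))

        peeled-exchange : ∀ {ks₂ ks₁ ks d₁ e₁ d₂ e₂ u} →
          Peel ks₂ ks₁ d₁ e₁ → Peel ks₁ ks d₂ e₂ → d₁ ≤ R → d₂ ≤ R → 9R ≤ W ks → HasTree wt ks₂ u →
          LessRoot ks (W ks + ((W ks₁ + (u + e₁)) + e₂))
        peeled-exchange {ks₂} {d₁ = d₁} {d₂ = d₂} P₁ P₂ d₁≤ d₂≤ 9R≤ t
          with as , bs , ≡.refl , a≤b , b≤a ← balanced-cut [] ks₂ (≤-trans (total-nonneg ks₂) (x≤x+y (W ks₂) 0≤R)) =
          cut-exchange as bs P₁ P₂ t 3R≰0
            (heavy-half w≈ 9R≤ d₁≤ d₂≤ b≤a)
            (heavy-half (trans w≈ (+-congʳ (+-comm (W as) (W bs)))) 9R≤ d₁≤ d₂≤ a≤b)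
            (≤-trans d₂≤ R≤3R) (near a≤b d₁≤ d₂≤) (near b≤a d₁≤ d₂≤)
          where
          w≈ = trans (Peel-total P₂) (trans (+-congʳ (trans (Peel-total P₁) (+-congʳ (total-++ as bs))))
                 (+-assoc (W as + W bs) d₁ d₂))

        private
          ≤-LessRoot : ∀ {ks u v} → u ≈ v → LessRoot ks u → LessRoot ks v
          ≤-LessRoot u≈v (xs , ys , p , q , eq , tp , tq , h) =
            xs , ys , p , q , eq , tp , tq , ≤-trans h (≤-reflexive u≈v)

        two-peels : ∀ xs x ys {ks d e u v} → 9R ≤ W (xs ++ x ∷ ys) →
          Peel ks (xs ++ ys) d e → d ≤ R → HasTree wt ks u → v ≈ W (xs ++ ys) + (u + e) →
          LessRoot (xs ++ x ∷ ys) (W (xs ++ x ∷ ys) + v)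
        two-peels xs x ys 9R≤ P d≤R t v≈ =
          ≤-LessRoot (+-congˡ (trans (+-identityʳ _) (sym v≈)))
            (peeled-exchange P (equal xs x ys ≡.refl) d≤R (wt≤R x) 9R≤ t)

        equal-exchange : ∀ xs x ys {ks v} → 9R ≤ W (xs ++ x ∷ ys) → HasTree wt ks v → ks ≡ xs ++ ys →
          LessRoot (xs ++ x ∷ ys) (W (xs ++ x ∷ ys) + v)
        equal-exchange xs x ys 9R≤ (leaf {z} _) eq = ⊥-elim (¬light (begin
          W (xs ++ x ∷ ys)       ≈⟨ total-insert xs x ys ⟩
          W (xs ++ ys) + wt x    ≡⟨ ≡.cong (λ ks → W ks + wt x) eq ⟨
          (wt z + 0#) + wt x     ≈⟨ +-congʳ (+-identityʳ (wt z)) ⟩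
          wt z + wt x            ≤⟨ +-mono-≤ (wt≤R z) (wt≤R x) ⟩
          R + R                  ∎) 9R≤)
          where open ≤-Reasoning
        equal-exchange xs x ys 9R≤ (equal as z bs eq t v≈) ≡.refl =
          two-peels xs x ys 9R≤ (≡.subst (λ ks → Peel (as ++ bs) ks (wt z) 0#) (≡.sym eq) (equal as z bs ≡.refl))
            (wt≤R z) t (trans v≈ (+-congˡ (sym (+-identityʳ _))))
        equal-exchange xs x ys 9R≤ (less as bs {v} {u₁} {u₂} eq t₁ t₂ v≈) ≡.refl with ++-crossing xs ys as bs eq
        ... | inj₁ (ms , ≡.refl , ≡.refl) with wt x ≤? W as
        -- With the two tests swapped, the keys of `as` skip the test for `x`, while `x` meets one
        -- more comparison.
        ...   | yes x≤ = as , ms ++ x ∷ ys , u₁ , _ , ++-assoc as ms (x ∷ ys) , t₁ ,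
          equal ms x ys ≡.refl t₂ refl , +-monoʳ-≤ _ (begin
            u₁ + (W (ms ++ x ∷ ys) + u₂)              ≈⟨ +-congˡ (+-congʳ (total-insert ms x ys)) ⟩
            u₁ + ((W (ms ++ ys) + wt x) + u₂)         ≤⟨ +-monoʳ-≤ u₁ (+-monoˡ-≤ u₂ (+-monoʳ-≤ _ x≤)) ⟩
            u₁ + ((W (ms ++ ys) + W as) + u₂)         ≈⟨ solve 4 (λ p m a q → p ⊕ ((m ⊕ a) ⊕ q) ⊜ (a ⊕ m) ⊕ (p ⊕ q)) refl u₁ (W (ms ++ ys)) (W as) u₂ ⟩
            (W as + W (ms ++ ys)) + (u₁ + u₂)         ≈⟨ +-congʳ (trans (reflexive (≡.cong W eq)) (total-++ as (ms ++ ys))) ⟨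
            W ((as ++ ms) ++ ys) + (u₁ + u₂)          ≈⟨ v≈ ⟨
            v                                         ∎)
          where open ≤-Reasoning
        -- Now `as` is no heavier than the single key `x`, so the less-than test also splits off
        -- weight at most R.
        ...   | no ¬x≤ = two-peels (as ++ ms) x ys 9R≤
          (≡.subst (λ ks → Peel (ms ++ ys) ks (W as) u₁) (≡.sym eq) (lessˡ t₁))
          (≤-trans (≰⇒≥ ¬x≤) (wt≤R x)) t₂ (trans v≈ (+-congˡ (+-comm u₁ u₂)))
        equal-exchange xs x ys 9R≤ (less as bs {v} {u₁} {u₂} eq t₁ t₂ v≈) ≡.refl
            | inj₂ (ms , ≡.refl , ≡.refl) with wt x ≤? W bs
        ...   | yes x≤ = xs ++ x ∷ ms , bs , _ , u₂ , ≡.sym (++-assoc xs (x ∷ ms) bs) ,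
          equal xs x ms ≡.refl t₁ refl , t₂ , +-monoʳ-≤ _ (begin
            (W (xs ++ x ∷ ms) + u₁) + u₂              ≈⟨ +-congʳ (+-congʳ (total-insert xs x ms)) ⟩
            ((W (xs ++ ms) + wt x) + u₁) + u₂         ≤⟨ +-monoˡ-≤ u₂ (+-monoˡ-≤ u₁ (+-monoʳ-≤ _ x≤)) ⟩
            ((W (xs ++ ms) + W bs) + u₁) + u₂         ≈⟨ +-assoc _ u₁ u₂ ⟩
            (W (xs ++ ms) + W bs) + (u₁ + u₂)         ≈⟨ +-congʳ (trans (reflexive (≡.cong W eq)) (total-++ (xs ++ ms) bs)) ⟨
            W (xs ++ ms ++ bs) + (u₁ + u₂)            ≈⟨ v≈ ⟨
            v                                         ∎)
          where open ≤-Reasoning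
        ...   | no ¬x≤ = two-peels xs x (ms ++ bs) 9R≤
          (≡.subst (λ ks → Peel (xs ++ ms) ks (W bs) u₂) (≡.sym eq) (lessʳ t₂))
          (≤-trans (≰⇒≥ ¬x≤) (wt≤R x)) t₁ v≈

        less-root : ∀ {ks v} → 9R ≤ W ks → HasTree wt ks v → LessRoot ks v
        less-root 9R≤ (leaf {x} _) =
          ⊥-elim (¬light (+-mono-≤ (wt≤R x) 0≤R) 9R≤)
        less-root 9R≤ (less xs ys eq t₁ t₂ v≈) = xs , ys , _ , _ , eq , t₁ , t₂ , ≤-reflexive (sym v≈)
        less-root 9R≤ (equal xs x ys ≡.refl t v≈) = ≤-LessRoot (sym v≈) (equal-exchange xs x ys 9R≤ t ≡.refl)

-- Comparison search trees as decision trees on the list of keys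

Sorted : ∀ {n} → List (Fin n) → Set
Sorted = AllPairs Fin._<_

module _ {r} {R : A → A → Set r} where

  AllPairs-++⁻ : ∀ xs {ys} → AllPairs R (xs ++ ys) →
    AllPairs R xs × AllPairs R ys × All (λ x → All (R x) ys) xs
  AllPairs-++⁻ []       Rys = [] , Rys , []
  AllPairs-++⁻ (x ∷ xs) (Rx ∷ R*) with Rxs , Rys , Rxys ← AllPairs-++⁻ xs R* =
    All.++⁻ˡ xs Rx ∷ Rxs , Rys , All.++⁻ʳ xs Rx ∷ Rxys

Sorted-remove : ∀ {n} xs (k : Fin n) {ys} → Sorted (xs ++ k ∷ ys) → Sorted (xs ++ ys) × All (_≢ k) (xs ++ ys)
Sorted-remove xs k sorted with sx , k<ys ∷ sy , x<y ← AllPairs-++⁻ xs sorted =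
  AllPairs.++⁺ sx sy (All.map All.tail x<y) ,
  All.++⁺ (All.map (Fin.<⇒≢ ∘ All.head) x<y) (All.map (λ k<y → Fin.<⇒≢ k<y ∘ ≡.sym) k<ys)

threshold : ∀ {n} (j : Fin n) ks → Sorted ks →
  ∃[ xs ] ∃[ ys ] ks ≡ xs ++ ys × All (Fin._< j) xs × All (λ y → ¬ y Fin.< j) ys
threshold j []       _ = [] , [] , ≡.refl , [] , []
threshold j (k ∷ ks) (k<ks ∷ sorted) with k Fin.<? j
... | no k≮j = [] , k ∷ ks , ≡.refl , [] , k≮j ∷ All.map (λ k<y y<j → k≮j (Fin.<-trans k<y y<j)) k<ks
... | yes k<j with xs , ys , ≡.refl , xs<j , ys≮j ← threshold j ks sorted =
  k ∷ xs , ys , ≡.refl , k<j ∷ xs<j , ys≮j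

module _ {n} (t : Test n) (y z : Tree n) {q : Fin n} where

  search-yes : answer t q ≡ true → search (node t y z) q ≡ in-yes (search y q)
  search-yes eq rewrite eq = ≡.refl

  search-no : answer t q ≡ false → search (node t y z) q ≡ in-no (search z q)
  search-no eq rewrite eq = ≡.refl

empty-or-not : ∀ (xs : List A) → xs ≡ [] ⊎ xs ≢ []
empty-or-not []      = inj₁ ≡.refl
empty-or-not (_ ∷ _) = inj₂ λ ()

module SearchTrees {c ℓ₁ ℓ₂} (F : ArchimedeanOrderedField c ℓ₁ ℓ₂) {n : ℕ}
  (w : Fin n → ArchimedeanOrderedField.Carrier F) where
  open OrderedField F
  open WeightedKeys F
  open SumProperties +-monoid using (sum-cong-≋)

  private W = total w

  -- Depth is taken along the search path and not through `leafOf`, so that it makes sense for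
  -- subtrees and for any list of keys.
  searchWeight : Tree n → Fin n → Carrier
  searchWeight t q = leafDepth (search t q) · w q

  searchCost : Tree n → List (Fin n) → Carrier
  searchCost t = total (searchWeight t)

  Finds : Tree n → Fin n → Set
  Finds t q = label t (search t q) ≡ q

  module _ (t : Test n) (y z : Tree n) where

    Finds-yes : ∀ {ks} → All (λ q → answer t q ≡ true) ks → All (Finds (node t y z)) ks → All (Finds y) ks
    Finds-yes yeses finds = All.zipWith (λ (eq , f) → ≡.trans (≡.cong (label (node t y z)) (≡.sym (search-yes t y z eq))) f) (yeses , finds)

    Finds-no : ∀ {ks} → All (λ q → answer t q ≡ false) ks → All (Finds (node t y z)) ks → All (Finds z) ks
    Finds-no noes finds = All.zipWith (λ (eq , f) → ≡.trans (≡.cong (label (node t y z)) (≡.sym (search-no t y z eq))) f) (noes , finds)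

    searchCost-child : ∀ {s ks} → All (λ q → leafDepth (search (node t y z) q) ≡ suc (leafDepth (search s q))) ks →
      searchCost (node t y z) ks ≈ W ks + searchCost s ks
    searchCost-child [] = sym (+-identityˡ 0#)
    searchCost-child {s} {k ∷ ks} (eq ∷ eqs) = trans
      (+-cong (reflexive (≡.cong (_· w k) eq)) (searchCost-child eqs))
      (solve 4 (λ a b c d → (a ⊕ b) ⊕ (c ⊕ d) ⊜ (a ⊕ c) ⊕ (b ⊕ d)) refl
        (w k) (searchWeight s k) (W ks) (searchCost s ks))

    searchCost-yes : ∀ {ks} → All (λ q → answer t q ≡ true) ks → searchCost (node t y z) ks ≈ W ks + searchCost y ks
    searchCost-yes yeses = searchCost-child (All.map (λ eq → ≡.cong leafDepth (search-yes t y z eq)) yeses)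

    searchCost-no : ∀ {ks} → All (λ q → answer t q ≡ false) ks → searchCost (node t y z) ks ≈ W ks + searchCost z ks
    searchCost-no noes = searchCost-child (All.map (λ eq → ≡.cong leafDepth (search-no t y z eq)) noes)

  module _ (w-nonneg : ∀ k → 0# ≤ w k) where

    ·-nonneg : ∀ m {x} → 0# ≤ x → 0# ≤ m · x
    ·-nonneg zero    0≤x = ≤-refl
    ·-nonneg (suc m) 0≤x = ≤-trans 0≤x (x≤x+y _ (·-nonneg m 0≤x))

    searchCost-nonneg : ∀ t ks → 0# ≤ searchCost t ks
    searchCost-nonneg t = total-nonneg {wt = searchWeight t} λ q → ·-nonneg (leafDepth (search t q)) (w-nonneg q)

    module _ (t : Test n) (y z : Tree n) where
      private
        below : ∀ ks {u v s} → v ≈ W ks + s → u ≤ s → u ≤ v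
        below ks {s = s} v≈ u≤ = ≤-trans u≤ (≤-trans (x≤x+y s (total-nonneg w-nonneg ks))
          (≤-reflexive (trans (+-comm s (W ks)) (sym v≈))))

      searchCost-≤-yes : ∀ {ks v} → All (λ q → answer t q ≡ true) ks → v ≤ searchCost y ks → v ≤ searchCost (node t y z) ks
      searchCost-≤-yes {ks} yeses = below ks (searchCost-yes t y z yeses)

      searchCost-≤-no : ∀ {ks v} → All (λ q → answer t q ≡ false) ks → v ≤ searchCost z ks → v ≤ searchCost (node t y z) ks
      searchCost-≤-no {ks} noes = below ks (searchCost-no t y z noes)

    -- Tests that do not separate the keys of `ks` are dropped, and the yes-child of an equal-to
    -- test shrinks to a leaf. Both can only lower the cost, so the bound is one-sided, and success
    -- of the searches suffices as a hypothesis on the tree.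
    search⇒HasTree : ∀ t ks → Sorted ks → ks ≢ [] → All (Finds t) ks → ∃[ v ] HasTree w ks v × v ≤ searchCost t ks
    search⇒HasTree (leaf k) [] _ ks≢[] _ = ⊥-elim (ks≢[] ≡.refl)
    search⇒HasTree (leaf k) (x ∷ [])     _ _ _ = 0# , leaf refl , searchCost-nonneg (leaf k) (x ∷ [])
    search⇒HasTree (leaf k) (x ∷ x′ ∷ _) ((x<x′ ∷ _) ∷ _) _ (k≡x ∷ k≡x′ ∷ _) =
      ⊥-elim (Fin.<⇒≢ x<x′ (≡.trans (≡.sym k≡x) k≡x′))
    search⇒HasTree (node (equal-to k) y z) ks sorted ks≢[] finds with _∈?_ Fin._≟_ k ks
    ... | no k∉ks
      with noes ← All.tabulate {xs = ks} (λ {q} q∈ → dec-false (q Fin.≟ k) (λ { ≡.refl → k∉ks q∈ }))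
      with v , t , v≤ ← search⇒HasTree z ks sorted ks≢[] (Finds-no (equal-to k) y z noes finds) =
      v , t , searchCost-≤-no (equal-to k) y z noes v≤
    ... | yes k∈ks
      with xs , ys , ≡.refl ← ∈-∃++ k∈ks
      with sorted′ , ≢k ← Sorted-remove xs k sorted
         | empty-or-not (xs ++ ys)
    ...   | inj₁ empty with ≡.refl ← ++-conicalˡ xs ys empty | ≡.refl ← ++-conicalʳ xs ys empty =
      0# , leaf refl , searchCost-nonneg (node (equal-to k) y z) (k ∷ [])
    ...   | inj₂ nonempty
      with noes ← All.map (λ {q} → dec-false (q Fin.≟ k)) ≢k
      with v , t , v≤ ← search⇒HasTree z (xs ++ ys) sorted′ nonempty
                          (Finds-no (equal-to k) y z noes (All.++⁺ (All.++⁻ˡ xs finds) (All.tail (All.++⁻ʳ xs finds)))) =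
      W (xs ++ k ∷ ys) + v , equal xs k ys ≡.refl t refl , (begin
        W (xs ++ k ∷ ys) + v                                      ≤⟨ +-monoʳ-≤ _ v≤ ⟩
        W (xs ++ k ∷ ys) + searchCost z (xs ++ ys)                ≈⟨ +-congʳ (total-insert xs k ys) ⟩
        (W (xs ++ ys) + w k) + searchCost z (xs ++ ys)            ≈⟨ solve 3 (λ a b c → (a ⊕ b) ⊕ c ⊜ (a ⊕ c) ⊕ b) refl _ _ _ ⟩
        (W (xs ++ ys) + searchCost z (xs ++ ys)) + w k            ≈⟨ +-congʳ (searchCost-no (equal-to k) y z noes) ⟨
        searchCost T (xs ++ ys) + w k                             ≤⟨ +-monoʳ-≤ _ (deep T-k (x≤x+y (w k) (·-nonneg (leafDepth (search y k)) (w-nonneg k)))) ⟩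
        searchCost T (xs ++ ys) + searchWeight T k                ≈⟨ total-insert xs k ys ⟨
        searchCost T (xs ++ k ∷ ys)                               ∎)
      where
      T = node (equal-to k) y z
      T-k : leafDepth (search T k) ≡ suc (leafDepth (search y k))
      T-k = ≡.cong leafDepth (search-yes (equal-to k) y z (dec-true (k Fin.≟ k) ≡.refl))
      deep : ∀ {l m u} → l ≡ m → u ≤ m · w k → u ≤ l · w k
      deep ≡.refl h = h
      open ≤-Reasoning
    search⇒HasTree (node (less-than j) y z) ks sorted ks≢[] finds
      with xs , ys , ≡.refl , xs<j , ys≮j ← threshold j ks sorted
      with yeses ← All.map (λ {q} → dec-true (q Fin.<? j)) xs<j
         | noes ← All.map (λ {q} → dec-false (q Fin.<? j)) ys≮j
         | sx , sy , _ ← AllPairs-++⁻ xs sorted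
         | fx , fy ← All.++⁻ xs finds
         | empty-or-not xs | empty-or-not ys
    ... | inj₁ ≡.refl | inj₁ ≡.refl = ⊥-elim (ks≢[] ≡.refl)
    ... | inj₁ ≡.refl | inj₂ ys≢[] with v , t , v≤ ← search⇒HasTree z ys sy ys≢[] (Finds-no (less-than j) y z noes fy) =
      v , t , searchCost-≤-no (less-than j) y z noes v≤
    ... | inj₂ xs≢[] | inj₁ ≡.refl rewrite ++-identityʳ xs
      with v , t , v≤ ← search⇒HasTree y xs sx xs≢[] (Finds-yes (less-than j) y z yeses fx) =
      v , t , searchCost-≤-yes (less-than j) y z yeses v≤
    ... | inj₂ xs≢[] | inj₂ ys≢[]
      with u , s , u≤ ← search⇒HasTree y xs sx xs≢[] (Finds-yes (less-than j) y z yeses fx)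
         | v , t , v≤ ← search⇒HasTree z ys sy ys≢[] (Finds-no (less-than j) y z noes fy) =
      W (xs ++ ys) + (u + v) , less xs ys ≡.refl s t refl , (begin
        W (xs ++ ys) + (u + v)                                    ≤⟨ +-monoʳ-≤ _ (+-mono-≤ u≤ v≤) ⟩
        W (xs ++ ys) + (searchCost y xs + searchCost z ys)        ≈⟨ +-congʳ (total-++ xs ys) ⟩
        (W xs + W ys) + (searchCost y xs + searchCost z ys)       ≈⟨ solve 4 (λ a b c d → (a ⊕ b) ⊕ (c ⊕ d) ⊜ (a ⊕ c) ⊕ (b ⊕ d)) refl _ _ _ _ ⟩
        (W xs + searchCost y xs) + (W ys + searchCost z ys)       ≈⟨ +-cong (searchCost-yes (less-than j) y z yeses) (searchCost-no (less-than j) y z noes) ⟨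
        searchCost T xs + searchCost T ys                         ≈⟨ total-++ xs ys ⟨
        searchCost T (xs ++ ys)                                   ∎)
      where
      T = node (less-than j) y z
      open ≤-Reasoning

  -- The second and the fourth component make `search t` a two-sided inverse of `label t` on `ks`,
  -- which yields bijectivity for the whole key set. The third component carries the induction: it
  -- determines how a test above a leaf answers for the label of that leaf.
  HasTree⇒search : ∀ {ks v} → HasTree w ks v → Sorted ks →
    ∃[ t ] All (Finds t) ks × (∀ l → label t l ∈ ks) × (∀ l → search t (label t l) ≡ l) × searchCost t ks ≈ v
  HasTree⇒search (leaf {k} v≈0) _ =
    leaf k , ≡.refl ∷ [] , (λ { here → here ≡.refl }) , (λ { here → ≡.refl }) ,
    trans (+-identityˡ 0#) (sym v≈0)
  HasTree⇒search (equal xs k ys {v} {u} ≡.refl s v≈) sorted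
    with sorted′ , ≢k ← Sorted-remove xs k sorted
    with z , finds , covers , faithful , cost≈ ← HasTree⇒search s sorted′ =
    T ,
    All.++⁺ (All.++⁻ˡ xs finds′) (≡.cong (label T) at-k ∷ All.++⁻ʳ xs finds′) ,
    (λ { (in-yes here) → ∈-insert xs
       ; (in-no l) → case ∈-++⁻ xs (covers l) of λ where
           (inj₁ ∈xs) → ∈-++⁺ˡ ∈xs
           (inj₂ ∈ys) → ∈-++⁺ʳ xs (there ∈ys) }) ,
    (λ { (in-yes here) → at-k
       ; (in-no l) → ≡.trans (search-no (equal-to k) (leaf k) z (All.lookup noes (covers l)))
                       (≡.cong in-no (faithful l)) }) ,
    (begin
      searchCost T (xs ++ k ∷ ys)                              ≈⟨ total-insert xs k ys ⟩
      searchCost T (xs ++ ys) + searchWeight T k               ≡⟨ ≡.cong (λ l → searchCost T (xs ++ ys) + leafDepth l · w k) at-k ⟩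
      searchCost T (xs ++ ys) + (w k + 0#)                     ≈⟨ +-congʳ (searchCost-no (equal-to k) (leaf k) z noes) ⟩
      (W (xs ++ ys) + searchCost z (xs ++ ys)) + (w k + 0#)    ≈⟨ solve 3 (λ a b c → (a ⊕ b) ⊕ (c ⊕ id) ⊜ (a ⊕ c) ⊕ b) refl _ _ _ ⟩
      (W (xs ++ ys) + w k) + searchCost z (xs ++ ys)           ≈⟨ +-cong (sym (total-insert xs k ys)) cost≈ ⟩
      W (xs ++ k ∷ ys) + u                                     ≈⟨ v≈ ⟨
      v                                                        ∎)
    where
    open import Relation.Binary.Reasoning.Setoid setoid
    T = node (equal-to k) (leaf k) z
    noes = All.map (λ {q} → dec-false (q Fin.≟ k)) ≢k
    finds′ = All.zipWith (λ (eq , f) → ≡.trans (≡.cong (label T) (search-no (equal-to k) (leaf k) z eq)) f) (noes , finds)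
    at-k : search T k ≡ in-yes here
    at-k = search-yes (equal-to k) (leaf k) z (dec-true (k Fin.≟ k) ≡.refl)
  HasTree⇒search (less xs [] eq s t v≈) sorted = ⊥-elim (HasTree⇒≢[] t ≡.refl)
  -- The cut is realised by a less-than test for the first key `j` of the right part.
  HasTree⇒search (less xs ys@(j ∷ ys′) {v} {u₁} {u₂} ≡.refl s₁ s₂ v≈) sorted
    with sx , sy@(j<ys′ ∷ _) , x<y ← AllPairs-++⁻ xs sorted
    with y , finds₁ , covers₁ , faithful₁ , cost₁ ← HasTree⇒search s₁ sx
       | z , finds₂ , covers₂ , faithful₂ , cost₂ ← HasTree⇒search s₂ sy =
    T ,
    All.++⁺ (All.zipWith (λ (eq , f) → ≡.trans (≡.cong (label T) (search-yes test y z eq)) f) (yeses , finds₁))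
            (All.zipWith (λ (eq , f) → ≡.trans (≡.cong (label T) (search-no test y z eq)) f) (noes , finds₂)) ,
    (λ { (in-yes l) → ∈-++⁺ˡ (covers₁ l)
       ; (in-no l)  → ∈-++⁺ʳ xs (covers₂ l) }) ,
    (λ { (in-yes l) → ≡.trans (search-yes test y z (All.lookup yeses (covers₁ l))) (≡.cong in-yes (faithful₁ l))
       ; (in-no l)  → ≡.trans (search-no test y z (All.lookup noes (covers₂ l))) (≡.cong in-no (faithful₂ l)) }) ,
    (begin
      searchCost T (xs ++ ys)                                  ≈⟨ total-++ xs ys ⟩
      searchCost T xs + searchCost T ys                        ≈⟨ +-cong (searchCost-yes test y z yeses) (searchCost-no test y z noes) ⟩
      (W xs + searchCost y xs) + (W ys + searchCost z ys)      ≈⟨ solve 4 (λ a b c d → (a ⊕ b) ⊕ (c ⊕ d) ⊜ (a ⊕ c) ⊕ (b ⊕ d)) refl _ _ _ _ ⟩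
      (W xs + W ys) + (searchCost y xs + searchCost z ys)      ≈⟨ +-cong (sym (total-++ xs ys)) (+-cong cost₁ cost₂) ⟩
      W (xs ++ ys) + (u₁ + u₂)                                 ≈⟨ v≈ ⟨
      v                                                        ∎)
    where
    open import Relation.Binary.Reasoning.Setoid setoid
    test = less-than j
    T = node test y z
    yeses = All.map (λ {q} q<ys → dec-true (q Fin.<? j) (All.head q<ys)) x<y
    noes = All.map (λ {q} j≤q → dec-false (q Fin.<? j) (ℕ.≤⇒≯ j≤q)) (ℕ.≤-refl ∷ All.map ℕ.<⇒≤ j<ys′)

  total-tabulate : ∀ (f : Fin n → Carrier) {m} (g : Fin m → Fin n) → total f (tabulate g) ≡ sum (f ∘ g)
  total-tabulate f {zero}  g = ≡.refl
  total-tabulate f {suc m} g = ≡.cong (f (g Fin.zero) +_) (total-tabulate f (g ∘ Fin.suc))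

  -- `leafOf k` and the leaf at which the search for `k` ends both carry the label `k`, so
  -- injectivity of `label` identifies them.
  cost≡searchCost : ∀ T → cost F w T ≈ searchCost (2WCST.tree T) (allFin n)
  cost≡searchCost T = trans
    (sum-cong-≋ λ k → reflexive (≡.cong (λ l → leafDepth l · w k)
      (proj₁ label-bijective (≡.trans (proj₂ (proj₂ label-bijective k) ≡.refl) (≡.sym (search-correct k))))))
    (reflexive (≡.sym (total-tabulate (searchWeight tree) (λ k → k))))
    where open 2WCST T

  allFin-sorted : Sorted (allFin n)
  allFin-sorted = AllPairs.tabulate⁺-< (λ i<j → i<j)

  IsOptimal⇒IsOptimalCost : (∀ k → 0# ≤ w k) → ∀ {v} → IsOptimal w (allFin n) v → IsOptimalCost F w v
  IsOptimal⇒IsOptimalCost w-nonneg {v} (s , minimal)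
    with t , finds , covers , faithful , cost≈ ← HasTree⇒search s allFin-sorted =
    (T , trans (cost≡searchCost T) cost≈) , λ T′ →
      case search⇒HasTree w-nonneg (2WCST.tree T′) (allFin n) allFin-sorted (HasTree⇒≢[] s)
             (All.tabulate λ {q} _ → 2WCST.search-correct T′ q) of λ where
        (u , s′ , u≤) → ≤-trans (minimal s′) (≤-trans u≤ (≤-reflexive (sym (cost≡searchCost T′))))
    where
    finds-all : ∀ q → Finds t q
    finds-all q = All.lookup finds (∈-allFin q)
    T : 2WCST n
    T = record
      { tree = t
      ; label-bijective =
          (λ {l} {l′} eq → ≡.trans (≡.sym (faithful l)) (≡.trans (≡.cong (search t) eq) (faithful l′))) ,
          λ q → search t q , λ { ≡.refl → finds-all q }
      ; search-correct = finds-all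
      }

-- Dynamic programming over intervals of keys

range : ℕ → ℕ → List ℕ
range i zero    = []
range i (suc l) = i ∷ range (suc i) l

length-range : ∀ i l → length (range i l) ≡ l
length-range i zero    = ≡.refl
length-range i (suc l) = ≡.cong suc (length-range (suc i) l)

range-++ : ∀ i k l → range i (k ℕ.+ l) ≡ range i k ++ range (i ℕ.+ k) l
range-++ i zero    l = ≡.cong (λ j → range j l) (≡.sym (ℕ.+-identityʳ i))
range-++ i (suc k) l = ≡.cong (i ∷_) (≡.trans (range-++ (suc i) k l)
  (≡.cong (λ j → range (suc i) k ++ range j l) (≡.sym (ℕ.+-suc i k))))

range-++⁻ : ∀ i l xs ys → range i l ≡ xs ++ ys →
  ∃[ k ] ∃[ m ] l ≡ k ℕ.+ m × xs ≡ range i k × ys ≡ range (i ℕ.+ k) m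
range-++⁻ i l []       ys eq = 0 , l , ≡.refl , ≡.refl ,
  ≡.trans (≡.sym eq) (≡.cong (λ j → range j l) (≡.sym (ℕ.+-identityʳ i)))
range-++⁻ i (suc l) (x ∷ xs) ys eq
  with ≡.refl , eq′ ← ∷-injective eq
  with k , m , ≡.refl , ≡.refl , ≡.refl ← range-++⁻ (suc i) l xs ys eq′ =
  suc k , m , ≡.refl , ≡.refl , ≡.cong (λ j → range j m) (≡.sym (ℕ.+-suc i k))

interval : ℕ → ℕ → List ℕ
interval i j = range i (j ℕ.∸ i)

interval-++ : ∀ {i s j} → i ℕ.≤ s → s ℕ.≤ j → interval i j ≡ interval i s ++ interval s j
interval-++ {i} {s} {j} i≤s s≤j = begin
  range i (j ℕ.∸ i)                              ≡⟨ ≡.cong (λ j → range i (j ℕ.∸ i)) (ℕ.m+[n∸m]≡n s≤j) ⟨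
  range i (s ℕ.+ (j ℕ.∸ s) ℕ.∸ i)                ≡⟨ ≡.cong (range i) (ℕ.+-∸-comm (j ℕ.∸ s) i≤s) ⟩
  range i ((s ℕ.∸ i) ℕ.+ (j ℕ.∸ s))              ≡⟨ range-++ i (s ℕ.∸ i) (j ℕ.∸ s) ⟩
  interval i s ++ range (i ℕ.+ (s ℕ.∸ i)) (j ℕ.∸ s)  ≡⟨ ≡.cong (λ s′ → interval i s ++ range s′ (j ℕ.∸ s)) (ℕ.m+[n∸m]≡n i≤s) ⟩
  interval i s ++ interval s j                   ∎
  where open ≡.≡-Reasoning

interval-++⁻ : ∀ {i j xs ys} → interval i j ≡ xs ++ ys → xs ≢ [] → ys ≢ [] →
  ∃[ s ] i ℕ.< s × s ℕ.< j × xs ≡ interval i s × ys ≡ interval s j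
interval-++⁻ {i} {j} {xs} {ys} eq xs≢[] ys≢[] with range-++⁻ i (j ℕ.∸ i) xs ys eq
... | zero  , _     , _ , ≡.refl , _      = ⊥-elim (xs≢[] ≡.refl)
... | suc _ , zero  , _ , _      , ≡.refl = ⊥-elim (ys≢[] ≡.refl)
... | suc k , suc m , j∸i≡ , ≡.refl , ≡.refl =
  s , ℕ.m<m+n i ℕ.z<s , ≡.subst (s ℕ.<_) (≡.sym j≡) (ℕ.m<m+n s ℕ.z<s) ,
  ≡.cong (range i) (≡.sym (ℕ.m+n∸m≡n i (suc k))) ,
  ≡.cong (range s) (≡.sym (≡.trans (≡.cong (ℕ._∸ s) j≡) (ℕ.m+n∸m≡n s (suc m))))
  where
  s = i ℕ.+ suc k
  i≤j : i ℕ.≤ j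
  i≤j = ℕ.<⇒≤ (ℕ.m∸n≢0⇒n<m λ j∸i≡0 → case ≡.trans (≡.sym j∸i≡) j∸i≡0 of λ ())
  j≡ : j ≡ s ℕ.+ suc m
  j≡ = ≡.trans (≡.sym (ℕ.m+[n∸m]≡n i≤j)) (≡.trans (≡.cong (i ℕ.+_) j∸i≡) (≡.sym (ℕ.+-assoc i (suc k) (suc m))))

map-++⁻ : ∀ (f : A → B) ks xs ys → map f ks ≡ xs ++ ys →
  ∃[ as ] ∃[ bs ] ks ≡ as ++ bs × map f as ≡ xs × map f bs ≡ ys
map-++⁻ f ks       []       ys eq = [] , ks , ≡.refl , ≡.refl , eq
map-++⁻ f (k ∷ ks) (x ∷ xs) ys eq with ≡.refl , eq′ ← ∷-injective eq
  with as , bs , ≡.refl , ≡.refl , p ← map-++⁻ f ks xs ys eq′ = k ∷ as , bs , ≡.refl , ≡.refl , p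

module Intervals {c ℓ₁ ℓ₂} (F : ArchimedeanOrderedField c ℓ₁ ℓ₂) where
  open OrderedField F
  open WeightedKeys F

  module _ {a b} {A : Set a} {B : Set b} {f : A → Carrier} {g : B → Carrier} where

    total-transport : ∀ {ks ls} → map f ks ≡ map g ls → total f ks ≡ total g ls
    total-transport {[]}     {[]}     _  = ≡.refl
    total-transport {k ∷ ks} {l ∷ ls} eq with p , eq′ ← ∷-injective eq = ≡.cong₂ _+_ p (total-transport eq′)

    -- Only the sequence of weights matters. This connects the three kinds of keys in use: elements
    -- of `Fin n`, positions in `ℕ`, and weight expressions of the machine.
    HasTree-transport : ∀ {ks ls v} → map f ks ≡ map g ls → HasTree f ks v → HasTree g ls v
    HasTree-transport {ls = _ ∷ []} eq (leaf v≈) = leaf v≈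
    HasTree-transport {ls = ls} eq (equal xs x ys {u = u} ≡.refl t v≈)
      with as , l ∷ bs , ≡.refl , p , q ← map-++⁻ g ls (map f xs) (f x ∷ map f ys) (≡.trans (≡.sym eq) (map-++ f xs (x ∷ ys))) =
      equal as l bs ≡.refl
        (HasTree-transport (≡.trans (map-++ f xs ys)
          (≡.trans (≡.cong₂ _++_ (≡.sym p) (≡.sym (proj₂ (∷-injective q)))) (≡.sym (map-++ g as bs)))) t)
        (trans v≈ (+-congʳ (reflexive (total-transport eq))))
    HasTree-transport {ls = ls} eq (less xs ys ≡.refl s t v≈)
      with as , bs , ≡.refl , p , q ← map-++⁻ g ls (map f xs) (map f ys) (≡.trans (≡.sym eq) (map-++ f xs ys)) =
      less as bs ≡.refl (HasTree-transport (≡.sym p) s) (HasTree-transport (≡.sym q) t)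
        (trans v≈ (+-congʳ (reflexive (total-transport eq))))

  IsOptimal-transport : ∀ {a b} {A : Set a} {B : Set b} {f : A → Carrier} {g : B → Carrier} {ks ls v} →
    map f ks ≡ map g ls → IsOptimal f ks v → IsOptimal g ls v
  IsOptimal-transport eq (t , minimal) =
    HasTree-transport eq t , λ t′ → minimal (HasTree-transport (≡.sym eq) t′)

  module _ {a} {A : Set a} {wt : A → Carrier} where

    IsOptimal-resp-≈ : ∀ {ks u v} → u ≈ v → IsOptimal wt ks u → IsOptimal wt ks v
    IsOptimal-resp-≈ u≈v (t , minimal) = HasTree-resp-≈ u≈v t , λ t′ → ≤-trans (≤-reflexive (sym u≈v)) (minimal t′)

    IsOptimal-unique : ∀ {ks u v} → IsOptimal wt ks u → IsOptimal wt ks v → u ≈ v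
    IsOptimal-unique (s , s-min) (t , t-min) = ≤-antisym (s-min t) (t-min s)

    nonempty-tree : ∀ k ks → ∃[ v ] HasTree wt (k ∷ ks) v
    nonempty-tree k []        = 0# , leaf refl
    nonempty-tree k (k′ ∷ ks) with v , t ← nonempty-tree k′ ks =
      _ , less (k ∷ []) (k′ ∷ ks) ≡.refl (leaf refl) t refl

  module Optima (R : Carrier) (1≤R : 1# ≤ R) (wt : ℕ → Carrier) (1≤wt : ∀ k → 1# ≤ wt k) (wt≤R : ∀ k → wt k ≤ R) where

    wt-nonneg : ∀ k → 0# ≤ wt k
    wt-nonneg k = ≤-trans 0≤1 (1≤wt k)

    Best : ℕ → ℕ → Carrier → Set _
    Best i j v = IsOptimal wt (interval i j) v

    length≤total : ∀ ks → length ks · 1# ≤ total wt ks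
    length≤total []       = ≤-refl
    length≤total (k ∷ ks) = +-mono-≤ (1≤wt k) (length≤total ks)

    ·1-mono : ∀ {m n} → m ℕ.≤ n → m · 1# ≤ n · 1#
    ·1-mono {n = zero}  ℕ.z≤n = ≤-refl
    ·1-mono {n = suc n} ℕ.z≤n = ≤-trans 0≤1 (x≤x+y 1# (·1-mono {n = n} ℕ.z≤n))
    ·1-mono (ℕ.s≤s m≤n) = +-monoʳ-≤ 1# (·1-mono m≤n)

    -- The invariant of the loop over cuts, with cuts up to `t` examined. Optimal costs are unique
    -- only up to `≈`, so the lower bound ranges over all of them and not over the stored ones.
    BestCut : ℕ → ℕ → ℕ → Carrier → Set _
    BestCut i j t m =
      (∃[ s ] i ℕ.< s × s ℕ.≤ t × ∃[ p ] ∃[ q ] Best i s p × Best s j q × p + q ≈ m) ×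
      (∀ {s p q} → i ℕ.< s → s ℕ.≤ t → Best i s p → Best s j q → m ≤ p + q)

    BestCut-first : ∀ {i j p q} → Best i (suc i) p → Best (suc i) j q → BestCut i j (suc i) (p + q)
    BestCut-first {i} {j} {p} {q} bp bq =
      (suc i , ℕ.≤-refl , ℕ.≤-refl , p , q , bp , bq , refl) , λ i<s s≤ → at (ℕ.≤-antisym s≤ i<s)
      where
      at : ∀ {s p′ q′} → s ≡ suc i → Best i s p′ → Best s j q′ → p + q ≤ p′ + q′
      at ≡.refl bp′ bq′ = ≤-reflexive (+-cong (IsOptimal-unique bp bp′) (IsOptimal-unique bq bq′))

    private
      extend : ∀ {i j t p q m m′} → Best i (suc t) p → Best (suc t) j q → m′ ≤ m → m′ ≤ p + q →
        (∀ {s p q} → i ℕ.< s → s ℕ.≤ t → Best i s p → Best s j q → m ≤ p + q) →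
        (∀ {s p q} → i ℕ.< s → s ℕ.≤ suc t → Best i s p → Best s j q → m′ ≤ p + q)
      extend bp bq m′≤m m′≤ below i<s s≤ bp′ bq′ with ℕ.m≤n⇒m<n∨m≡n s≤
      ... | inj₁ (ℕ.s≤s s≤t) = ≤-trans m′≤m (below i<s s≤t bp′ bq′)
      ... | inj₂ ≡.refl = ≤-trans m′≤ (≤-reflexive (+-cong (IsOptimal-unique bp bp′) (IsOptimal-unique bq bq′)))

    BestCut-better : ∀ {i j t p q m} → i ℕ.≤ t → Best i (suc t) p → Best (suc t) j q →
      BestCut i j t m → p + q ≤ m → BestCut i j (suc t) (p + q)
    BestCut-better i≤t bp bq (_ , below) better =
      (_ , ℕ.s≤s i≤t , ℕ.≤-refl , _ , _ , bp , bq , refl) , extend bp bq better ≤-refl below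

    BestCut-worse : ∀ {i j t p q m} → Best i (suc t) p → Best (suc t) j q →
      BestCut i j t m → m ≤ p + q → BestCut i j (suc t) m
    BestCut-worse bp bq ((s , i<s , s≤t , at) , below) worse =
      (s , i<s , ℕ.m≤n⇒m≤1+n s≤t , at) , extend bp bq ≤-refl worse below

    private
      split-≤ : ∀ {xs ys p q p′ q′} → IsOptimal wt xs p → IsOptimal wt ys q → HasTree wt xs p′ → HasTree wt ys q′ →
        p + q ≤ p′ + q′
      split-≤ (_ , p≤) (_ , q≤) t t′ = +-mono-≤ (p≤ t) (q≤ t′)

    -- BestCut compares m only with optima, so it says nothing about a cut without known optima.
    BestCut⇒Best : ∀ {i t m K} → thrice (thrice R) ≤ K · 1# → K ℕ.≤ suc t ℕ.∸ i →
      (∀ {s} → i ℕ.< s → s ℕ.≤ t → (∃[ p ] Best i s p) × (∃[ q ] Best s (suc t) q)) →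
      BestCut i (suc t) t m → Best i (suc t) (total wt (interval i (suc t)) + m)
    BestCut⇒Best {i} {t} {m} {K} 9R≤ K≤ known ((s , i<s , s≤t , p , q , (tp , _) , (tq , _) , p+q≈) , below) =
      less _ _ (interval-++ (ℕ.<⇒≤ i<s) (ℕ.m≤n⇒m≤1+n s≤t)) tp tq (+-congˡ (sym p+q≈)) , minimal
      where
      -- The lower bound 1 on the weights turns the number of keys into a total weight of at least
      -- 9R.
      heavy : thrice (thrice R) ≤ total wt (interval i (suc t))
      heavy = ≤-trans 9R≤ (≤-trans (·1-mono (ℕ.≤-trans K≤ (ℕ.≤-reflexive (≡.sym (length-range i (suc t ℕ.∸ i))))))
        (length≤total (interval i (suc t))))
      minimal : ∀ {u} → HasTree wt (interval i (suc t)) u → total wt (interval i (suc t)) + m ≤ u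
      minimal tree
        with xs , ys , _ , _ , eq , tx , ty , h ← less-root wt-nonneg R 1≤R wt≤R heavy tree
        with s′ , i<s′ , ℕ.s≤s s′≤t , ≡.refl , ≡.refl ← interval-++⁻ {i} eq (HasTree⇒≢[] tx) (HasTree⇒≢[] ty)
        with (_ , bp) , (_ , bq) ← known i<s′ s′≤t =
        ≤-trans (+-monoʳ-≤ _ (≤-trans (below i<s′ s′≤t bp bq) (split-≤ bp bq tx ty))) h

-- Programs

splits : List A → List (List A × List A)
splits []       = ([] , []) ∷ []
splits (x ∷ xs) = ([] , x ∷ xs) ∷ map (λ (as , bs) → x ∷ as , bs) (splits xs)

∈-splits⁺ : ∀ (as bs : List A) → (as , bs) ∈ splits (as ++ bs)
∈-splits⁺ []       []       = here ≡.refl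
∈-splits⁺ []       (b ∷ bs) = here ≡.refl
∈-splits⁺ (a ∷ as) bs       = there (∈-map⁺ _ (∈-splits⁺ as bs))

∈-splits⁻ : ∀ {as bs} (xs : List A) → (as , bs) ∈ splits xs → xs ≡ as ++ bs
∈-splits⁻ []       (here ≡.refl) = ≡.refl
∈-splits⁻ (x ∷ xs) (here ≡.refl) = ≡.refl
∈-splits⁻ (x ∷ xs) (there ∈m) with (as , bs) , ∈s , ≡.refl ← ∈-map⁻ _ ∈m = ≡.cong (x ∷_) (∈-splits⁻ xs ∈s)

does-true : ∀ {p} {P : Set p} (P? : Dec P) → does P? ≡ true → P
does-true (yes p) _ = p

does-false : ∀ {p} {P : Set p} (P? : Dec P) → does P? ≡ false → ¬ P
does-false (no ¬p) _ = ¬p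

module Machine {c ℓ₁ ℓ₂} (F : ArchimedeanOrderedField c ℓ₁ ℓ₂) where
  open OrderedField F
  open WeightedKeys F
  open Intervals F using (nonempty-tree)
  open State

  -- An upper bound on the running time, provided that no loop makes more than n iterations
  -- at a time; a conditional is charged for both branches.
  timeBound : ℕ → Program Carrier → ℕ
  timeBound n skip                     = 1
  timeBound n (storeIndex d e)         = 1 ℕ.+ indexTime d ℕ.+ indexTime e
  timeBound n (storeWeight d e)        = 1 ℕ.+ indexTime d ℕ.+ weightTime e
  timeBound n (P ⨾ Q)                  = timeBound n P ℕ.+ timeBound n Q
  timeBound n (ifᶜ b then P else Q)    = conditionTime b ℕ.+ (timeBound n P ℕ.+ timeBound n Q)
  timeBound n (while b loop P)         = n ℕ.* (conditionTime b ℕ.+ timeBound n P) ℕ.+ conditionTime b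

  data LoopDepth : Program Carrier → ℕ → Set c where
    skip        : ∀ {d} → LoopDepth skip d
    storeIndex  : ∀ {a e d} → LoopDepth (storeIndex a e) d
    storeWeight : ∀ {a e d} → LoopDepth (storeWeight a e) d
    _⨾_         : ∀ {P Q d} → LoopDepth P d → LoopDepth Q d → LoopDepth (P ⨾ Q) d
    if          : ∀ {b P Q d} → LoopDepth P d → LoopDepth Q d → LoopDepth (ifᶜ b then P else Q) d
    while       : ∀ {b P d} → LoopDepth P d → LoopDepth (while b loop P) (suc d)

  -- `factor` is fixed before `n` and becomes the constant of the running time. For `1 ≤ n` the
  -- power `n ^ d` is at least 1 and so absorbs constant terms.
  record O (d : ℕ) (f : ℕ → ℕ) : Set where
    constructor _,_
    field
      factor : ℕ
      bound  : ∀ n → 1 ℕ.≤ n → f n ℕ.≤ factor ℕ.* n ^ d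

  O-const : ∀ {d} k → O d (λ _ → k)
  O-const {d} k = k , λ { n@(suc _) _ → ℕ.m≤m*n k (n ^ d) {{ℕ.m^n≢0 n d}} }

  O-+ : ∀ {d f g} → O d f → O d g → O d (λ n → f n ℕ.+ g n)
  O-+ {d} (C , f≤) (D , g≤) = C ℕ.+ D , λ n 1≤n →
    ℕ.≤-trans (ℕ.+-mono-≤ (f≤ n 1≤n) (g≤ n 1≤n)) (ℕ.≤-reflexive (≡.sym (ℕ.*-distribʳ-+ (n ^ d) C D)))

  O-* : ∀ {d f} → O d f → O (suc d) (λ n → n ℕ.* f n)
  O-* {d} {f} (C , f≤) = C , λ n 1≤n → ℕ.≤-trans (ℕ.*-monoʳ-≤ n (f≤ n 1≤n))
    (ℕ.≤-reflexive (≡.trans (≡.sym (ℕ.*-assoc n C (n ^ d)))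
      (≡.trans (≡.cong (ℕ._* n ^ d) (ℕ.*-comm n C)) (ℕ.*-assoc C n (n ^ d)))))

  -- Loop-free code, however large, contributes a constant; only the nesting of loops raises the
  -- exponent.
  timeBound-polynomial : ∀ {P d} → LoopDepth P d → O d (λ n → timeBound n P)
  timeBound-polynomial skip                    = O-const 1
  timeBound-polynomial (storeIndex {a} {e})    = O-const (1 ℕ.+ indexTime a ℕ.+ indexTime e)
  timeBound-polynomial (storeWeight {a} {e})   = O-const (1 ℕ.+ indexTime a ℕ.+ weightTime e)
  timeBound-polynomial (P ⨾ Q)                 = O-+ (timeBound-polynomial P) (timeBound-polynomial Q)
  timeBound-polynomial (if {b} P Q)            =
    O-+ (O-const (conditionTime b)) (O-+ (timeBound-polynomial P) (timeBound-polynomial Q))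
  timeBound-polynomial (while {b} P)           =
    O-+ (O-* (O-+ (O-const (conditionTime b)) (timeBound-polynomial P))) (O-const (conditionTime b))

  -- The best candidate so far is remembered by the position in the program, not in memory.
  -- This takes exponentially many instructions, but the values of the candidates stay fixed.
  bestOf : IndexExp → WeightExp Carrier → List (WeightExp Carrier) → Program Carrier
  bestOf a e []        = storeWeight a e
  bestOf a e (e′ ∷ es) = ifᶜ e′ ≤ᵂ e then bestOf a e′ es else bestOf a e es

  minimise : IndexExp → List (WeightExp Carrier) → Program Carrier
  minimise a []       = skip
  minimise a (e ∷ es) = bestOf a e es

  bestOf-loop-free : ∀ a e es {d} → LoopDepth (bestOf a e es) d
  bestOf-loop-free a e []        = storeWeight
  bestOf-loop-free a e (e′ ∷ es) = if (bestOf-loop-free a e′ es) (bestOf-loop-free a e es)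

  minimise-loop-free : ∀ a es {d} → LoopDepth (minimise a es) d
  minimise-loop-free a []       = skip
  minimise-loop-free a (e ∷ es) = bestOf-loop-free a e es

  totalExp : List (WeightExp Carrier) → WeightExp Carrier
  totalExp []       = const 0#
  totalExp (e ∷ es) = e +ᵂ totalExp es

  -- The first argument bounds the recursion depth.
  treeCosts : ℕ → List (WeightExp Carrier) → List (WeightExp Carrier)
  private
    leafCosts : List (WeightExp Carrier) → List (WeightExp Carrier)
    leafCosts (_ ∷ []) = const 0# ∷ []
    leafCosts _        = []

    equalCosts lessCosts : ℕ → List (WeightExp Carrier) × List (WeightExp Carrier) → List (WeightExp Carrier)
    equalCosts f (xs , [])     = []
    equalCosts f (xs , x ∷ ys) = map (totalExp (xs ++ x ∷ ys) +ᵂ_) (treeCosts f (xs ++ ys))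
    lessCosts f (xs , ys)      =
      cartesianProductWith (λ d e → totalExp (xs ++ ys) +ᵂ (d +ᵂ e)) (treeCosts f xs) (treeCosts f ys)

  treeCosts zero    es = []
  treeCosts (suc f) es = leafCosts es ++ concatMap (equalCosts f) (splits es) ++ concatMap (lessCosts f) (splits es)

  module _ (σ : State Carrier) where
    private eval = evalWeight F σ

    totalExp-total : ∀ es → eval (totalExp es) ≡ total eval es
    totalExp-total []       = ≡.refl
    totalExp-total (e ∷ es) = ≡.cong (eval e +_) (totalExp-total es)

    -- The expressions themselves serve as keys, weighed by their values in `σ`.
    treeCosts-sound : ∀ f es {e} → e ∈ treeCosts f es → HasTree eval es (eval e)
    treeCosts-sound (suc f) es e∈ with ∈-++⁻ (leafCosts es) e∈
    treeCosts-sound (suc f) (_ ∷ []) _ | inj₁ (here ≡.refl) = leaf refl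
    ... | inj₂ e∈ with ∈-++⁻ (concatMap (equalCosts f) (splits es)) e∈
    ...   | inj₁ e∈ with find (∈-concatMap⁻ (equalCosts f) e∈)
    ...     | (xs , x ∷ ys) , ∈s , ∈m
      with ≡.refl ← ∈-splits⁻ es ∈s
      with _ , ∈t , ≡.refl ← ∈-map⁻ _ ∈m =
      equal xs x ys ≡.refl (treeCosts-sound f (xs ++ ys) ∈t) (+-congʳ (reflexive (totalExp-total es)))
    treeCosts-sound (suc f) es _ | inj₂ _ | inj₂ e∈ with find (∈-concatMap⁻ (lessCosts f) e∈)
    ...     | (xs , ys) , ∈s , ∈c
      with ≡.refl ← ∈-splits⁻ es ∈s
      with _ , _ , ∈t₁ , ∈t₂ , ≡.refl ← ∈-cartesianProductWith⁻ _ (treeCosts f xs) (treeCosts f ys) ∈c =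
      less xs ys ≡.refl (treeCosts-sound f xs ∈t₁) (treeCosts-sound f ys ∈t₂) (+-congʳ (reflexive (totalExp-total es)))

    -- Both sides of a cut are nonempty since they carry trees, so every test leaves strictly
    -- shorter lists and the length of `es` suffices as recursion depth.
    treeCosts-complete : ∀ f es {v} → length es ℕ.≤ f → HasTree eval es v → ∃[ e ] e ∈ treeCosts f es × eval e ≈ v
    treeCosts-complete zero    []          _   t = ⊥-elim (HasTree⇒≢[] t ≡.refl)
    treeCosts-complete (suc f) es          _   (leaf v≈) = const 0# , here ≡.refl , sym v≈
    treeCosts-complete (suc f) es len≤ (equal xs x ys ≡.refl t v≈)
      with e , e∈ , e≈ ← treeCosts-complete f (xs ++ ys)
             (ℕ.≤-pred (ℕ.≤-trans (ℕ.≤-reflexive (≡.sym (length-++-sucʳ xs x ys))) len≤)) t =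
      _ ,
      ∈-++⁺ʳ (leafCosts es) (∈-++⁺ˡ (∈-concatMap⁺ (equalCosts f) (lose (∈-splits⁺ xs (x ∷ ys)) (∈-map⁺ _ e∈)))) ,
      trans (+-cong (reflexive (totalExp-total es)) e≈) (sym v≈)
    treeCosts-complete (suc f) es len≤ (less []       ys     ≡.refl s t v≈) = ⊥-elim (HasTree⇒≢[] s ≡.refl)
    treeCosts-complete (suc f) es len≤ (less (_ ∷ _)  []     ≡.refl s t v≈) = ⊥-elim (HasTree⇒≢[] t ≡.refl)
    treeCosts-complete (suc f) es len≤ (less xs@(x ∷ xs′) ys@(y ∷ ys′) ≡.refl s t v≈)
      with len ← ≡.subst (ℕ._≤ suc f) (length-++ xs {ys}) len≤
      with d , d∈ , d≈ ← treeCosts-complete f xs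
             (ℕ.≤-pred (ℕ.≤-trans (ℕ.m<m+n (length xs) ℕ.z<s) len)) s
         | e , e∈ , e≈ ← treeCosts-complete f ys (ℕ.≤-trans (ℕ.m≤n+m (length ys) (length xs′)) (ℕ.≤-pred len)) t =
      _ ,
      ∈-++⁺ʳ (leafCosts es) (∈-++⁺ʳ (concatMap (equalCosts f) (splits es))
        (∈-concatMap⁺ (lessCosts f) (lose (∈-splits⁺ xs ys) (∈-cartesianProductWith⁺ _ d∈ e∈)))) ,
      trans (+-cong (reflexive (totalExp-total es)) (+-cong d≈ e≈)) (sym v≈)

  -- Total correctness within a time bound

  module Halting (N : ℕ) where

    -- A total-correctness judgement in which the time bound is determined by the program alone.
    -- Proofs about concrete programs therefore concern states only, and time enters just through
    -- the number of iterations of each loop.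
    Halts : ∀ {q} → Program Carrier → State Carrier → (State Carrier → Set q) → Set (c ⊔ q)
    Halts P σ Q = ∃[ τ ] ∃[ t ] Runs F P σ t τ × t ℕ.≤ timeBound N P × Q τ

    private variable
      q : Level
      P P′ : Program Carrier
      Q : State Carrier → Set q
      σ : State Carrier

    halts-map : ∀ {p} {R : State Carrier → Set p} → (∀ {τ} → R τ → Q τ) → Halts P σ R → Halts P σ Q
    halts-map f (τ , t , run , t≤ , post) = τ , t , run , t≤ , f post

    halts-seq : Halts P σ (λ τ → Halts P′ τ Q) → Halts (P ⨾ P′) σ Q
    halts-seq (τ , s , run , s≤ , (υ , t , run′ , t≤ , post)) =
      υ , s ℕ.+ t , seq run run′ , ℕ.+-mono-≤ s≤ t≤ , post

    halts-skip : Q σ → Halts skip σ Q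
    halts-skip post = _ , 1 , skip , ℕ.≤-refl , post

    -- The address and the value are passed along with evaluation equations, so that the
    -- postcondition mentions the intended cell and content in place of unevaluated expressions.
    halts-storeIndex : ∀ {d e m ws} x v → evalIndex m d ≡ x → evalIndex m e ≡ v →
      Q (state (m [ x ≔ v ]) ws) → Halts (storeIndex d e) (state m ws) Q
    halts-storeIndex _ _ ≡.refl ≡.refl post = _ , _ , storeIndex , ℕ.≤-refl , post

    halts-storeWeight : ∀ {d e m ws} x v → evalIndex m d ≡ x → evalWeight F (state m ws) e ≡ v →
      Q (state m (ws [ x ≔ v ])) → Halts (storeWeight d e) (state m ws) Q
    halts-storeWeight _ _ ≡.refl ≡.refl post = _ , _ , storeWeight , ℕ.≤-refl , post

    halts-if : ∀ {b} → (evalCondition F σ b ≡ true → Halts P σ Q) → (evalCondition F σ b ≡ false → Halts P′ σ Q) →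
      Halts (ifᶜ b then P else P′) σ Q
    halts-if {σ = σ} {P = P} {P′ = P′} {b = b} yes-branch no-branch with evalCondition F σ b in eq
    ... | true with τ , t , run , t≤ , post ← yes-branch ≡.refl =
      τ , _ , if-true eq run , ℕ.+-monoʳ-≤ (conditionTime b) (ℕ.≤-trans t≤ (ℕ.m≤m+n _ (timeBound N P′))) , post
    ... | false with τ , t , run , t≤ , post ← no-branch ≡.refl =
      τ , _ , if-false eq run , ℕ.+-monoʳ-≤ (conditionTime b) (ℕ.≤-trans t≤ (ℕ.m≤n+m _ (timeBound N P))) , post

    halts-if-≤ᴵ : ∀ {d e m ws} x y → evalIndex m d ≡ x → evalIndex m e ≡ y →
      (x ℕ.≤ y → Halts P (state m ws) Q) → (y ℕ.< x → Halts P′ (state m ws) Q) →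
      Halts (ifᶜ d ≤ᴵ e then P else P′) (state m ws) Q
    halts-if-≤ᴵ x y ≡.refl ≡.refl yes-branch no-branch = halts-if
      (λ h → yes-branch (does-true (x ℕ.≤? y) h))
      (λ h → no-branch (ℕ.≰⇒> (does-false (x ℕ.≤? y) h)))

    halts-if-≤ᵂ : ∀ {d e} x y → evalWeight F σ d ≡ x → evalWeight F σ e ≡ y →
      (x ≤ y → Halts P σ Q) → (y ≤ x → Halts P′ σ Q) →
      Halts (ifᶜ d ≤ᵂ e then P else P′) σ Q
    halts-if-≤ᵂ x y ≡.refl ≡.refl yes-branch no-branch = halts-if
      (λ h → yes-branch (does-true (x ≤? y) h))
      (λ h → no-branch (≰⇒≥ (does-false (x ≤? y) h)))

    -- Inv k is the invariant with k iterations left.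
    halts-while : ∀ {b} (Inv : ℕ → State Carrier → Set q) →
      (∀ {k σ} → Inv (suc k) σ → evalCondition F σ b ≡ true × Halts P σ (Inv k)) →
      (∀ {σ} → Inv 0 σ → evalCondition F σ b ≡ false) →
      ∀ {k σ} → k ℕ.≤ N → Inv k σ → Halts (while b loop P) σ (Inv 0)
    halts-while {P = P} {b = b} Inv step stop k≤N inv = finish k≤N (iterate _ inv)
      where
      body = conditionTime b ℕ.+ timeBound N P
      finish : ∀ {k σ} → k ℕ.≤ N →
        (∃[ τ ] ∃[ t ] Runs F (while b loop P) σ t τ × t ℕ.≤ k ℕ.* body ℕ.+ conditionTime b × Inv 0 τ) →
        Halts (while b loop P) σ (Inv 0)
      finish k≤N (τ , t , run , t≤ , post) =
        τ , t , run , ℕ.≤-trans t≤ (ℕ.+-monoˡ-≤ (conditionTime b) (ℕ.*-monoˡ-≤ body k≤N)) , post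
      iterate : ∀ k {σ} → Inv k σ →
        ∃[ τ ] ∃[ t ] Runs F (while b loop P) σ t τ × t ℕ.≤ k ℕ.* body ℕ.+ conditionTime b × Inv 0 τ
      iterate zero    inv = _ , _ , while-false (stop inv) , ℕ.≤-refl , inv
      iterate (suc k) inv
        with holds , τ , s , run , s≤ , inv′ ← step inv
        with υ , t , run′ , t≤ , post ← iterate k inv′ =
        υ , _ , while-true holds run run′ ,
        ℕ.≤-trans (ℕ.+-mono-≤ (ℕ.+-monoʳ-≤ (conditionTime b) s≤) t≤)
                  (ℕ.≤-reflexive (≡.sym (ℕ.+-assoc body (k ℕ.* body) (conditionTime b)))) ,
        post

    bestOf-halts : ∀ {a m ws} x e es → evalIndex m a ≡ x →
      let eval = evalWeight F (state m ws) in
      (∀ {e₀} → e₀ ∈ e ∷ es → All (λ e′ → eval e₀ ≤ eval e′) (e ∷ es) → Q (state m (ws [ x ≔ eval e₀ ]))) →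
      Halts (bestOf a e es) (state m ws) Q
    bestOf-halts x e []        a≡x post = halts-storeWeight x _ a≡x ≡.refl (post (here ≡.refl) (≤-refl ∷ []))
    bestOf-halts x e (e′ ∷ es) a≡x post = halts-if-≤ᵂ _ _ ≡.refl ≡.refl
      (λ e′≤e → bestOf-halts x e′ es a≡x λ where
        ∈es (≤e′ ∷ ≤es) → post (there ∈es) (≤-trans ≤e′ e′≤e ∷ ≤e′ ∷ ≤es))
      (λ e≤e′ → bestOf-halts x e es a≡x λ where
        (here ≡.refl) (≤e ∷ ≤es) → post (here ≡.refl) (≤e ∷ e≤e′ ∷ ≤es)
        (there ∈es) (≤e ∷ ≤es) → post (there (there ∈es)) (≤e ∷ ≤-trans ≤e e≤e′ ∷ ≤es))

    minimise-halts : ∀ {a m ws} x f es → evalIndex m a ≡ x → es ≢ [] → length es ℕ.≤ f →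
      let eval = evalWeight F (state m ws) in
      (∀ {v} → IsOptimal eval es v → Q (state m (ws [ x ≔ v ]))) →
      Halts (minimise a (treeCosts f es)) (state m ws) Q
    minimise-halts x f [] _ es≢[] _ _ = ⊥-elim (es≢[] ≡.refl)
    minimise-halts {m = m} {ws} x f es@(e₀ ∷ es′) a≡x _ len≤ post
      -- Both properties of the candidate list are bound first, so that the case distinction on the
      -- list also specialises them.
      with complete ← (λ {v} → treeCosts-complete (state m ws) f es {v} len≤)
         | sound ← (λ {e} → treeCosts-sound (state m ws) f es {e})
      with treeCosts f es
    ... | [] = case complete (proj₂ (nonempty-tree e₀ es′)) of λ ()
    ... | e ∷ costs = bestOf-halts x e costs a≡x λ {d} d∈ d≤ → post (sound d∈ , λ t →
      case complete t of λ (e′ , e′∈ , e′≈) → ≤-trans (All.lookup d≤ e′∈) (≤-reflexive e′≈))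

-- The algorithm

module _ {a} {A : Set a} (m : ℕ → A) where

  update-same : ∀ i {x} → (m [ i ≔ x ]) i ≡ x
  update-same i rewrite dec-true (i ℕ.≟ i) ≡.refl = ≡.refl

  update-other : ∀ {i j x} → j ≢ i → (m [ i ≔ x ]) j ≡ m j
  update-other {i} {j} j≢i rewrite dec-false (j ℕ.≟ i) j≢i = ≡.refl

-- The optimal costs of the intervals [i , j) are computed for j = 1, …, n and, for fixed j,
-- for i = j - 1, …, 0.  Index cells 0 to 3 hold n, j, i and the current cut; index cell 4 + j
-- holds j (n + 1), and weight cell j (n + 1) + i the optimal cost of [i , j) for i < j and the
-- total weight of the interval under consideration for i = j.
module Algorithm {c ℓ₁ ℓ₂} (F : ArchimedeanOrderedField c ℓ₁ ℓ₂) (K : ℕ) where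
  open OrderedField F
  open Machine F

  sizeᴵ rightᴵ leftᴵ cutᴵ : IndexExp
  sizeᴵ  = load (const 0)
  rightᴵ = load (const 1)
  leftᴵ  = load (const 2)
  cutᴵ   = load (const 3)

  -- Indices cannot be multiplied, so the start of each row is looked up in a table that grows by
  -- repeated addition.
  cell : IndexExp → IndexExp → IndexExp
  cell i j = load (const 4 +ᴵ j) +ᴵ i

  target totalCell : IndexExp
  target    = cell leftᴵ rightᴵ
  totalCell = cell rightᴵ rightᴵ

  cutCost : WeightExp Carrier
  cutCost = load (cell leftᴵ cutᴵ) +ᵂ load (cell cutᴵ rightᴵ)

  keyWeights : ℕ → ℕ → List (WeightExp Carrier)
  keyWeights o zero    = []
  keyWeights o (suc l) = load (leftᴵ +ᴵ const o) ∷ keyWeights (suc o) l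

  -- A candidate expression refers to a fixed number of keys, so each length needs its own
  -- minimisation. On intervals of at most `suc k` keys, the else branch is reached with exactly
  -- `suc k` of them.
  short : ℕ → Program Carrier
  short zero    = skip
  short (suc k) = ifᶜ (rightᴵ ∸ᴵ leftᴵ) ≤ᴵ const k
    then short k
    else minimise target (treeCosts (suc k) (keyWeights 0 (suc k)))

  nextCut : Program Carrier
  nextCut = storeIndex (const 3) (cutᴵ +ᴵ const 1) ⨾
    (ifᶜ cutCost ≤ᵂ load target then storeWeight target cutCost else skip)

  long : Program Carrier
  long =
    storeIndex (const 3) (leftᴵ +ᴵ const 1) ⨾
    storeWeight target cutCost ⨾
    -- The body moves on to `cut + 1`, which has to stay strictly below the right end.
    (while (cutᴵ +ᴵ const 2) ≤ᴵ rightᴵ loop nextCut) ⨾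
    storeWeight target (load totalCell +ᵂ load target)

  nextLeft : Program Carrier
  nextLeft =
    storeIndex (const 2) (leftᴵ ∸ᴵ const 1) ⨾
    storeWeight totalCell (load leftᴵ +ᵂ load totalCell) ⨾
    -- With `suc K` in place of `K`, an interval given to `long` has at least two keys whatever `K`
    -- is, so its first cut lies strictly inside.
    (ifᶜ (rightᴵ ∸ᴵ leftᴵ) ≤ᴵ const (suc K) then short (suc K) else long)

  nextRight : Program Carrier
  nextRight =
    -- Cell `5 + right` is cell `4 + (right + 1)`: the start of the new row is stored while `rightᴵ`
    -- still holds the previous right end.
    storeIndex (const 5 +ᴵ rightᴵ) (load (const 4 +ᴵ rightᴵ) +ᴵ (sizeᴵ +ᴵ const 1)) ⨾
    storeIndex (const 1) (rightᴵ +ᴵ const 1) ⨾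
    storeIndex (const 2) rightᴵ ⨾
    storeWeight totalCell (const 0#) ⨾
    (while const 1 ≤ᴵ leftᴵ loop nextLeft)

  algorithm : Program Carrier
  algorithm =
    (while (rightᴵ +ᴵ const 1) ≤ᴵ sizeᴵ loop nextRight) ⨾
    storeWeight (const 0) (load (cell (const 0) sizeᴵ))

  short-loop-free : ∀ k {d} → LoopDepth (short k) d
  short-loop-free zero    = skip
  short-loop-free (suc k) = if (short-loop-free k) (minimise-loop-free target (treeCosts (suc k) (keyWeights 0 (suc k))))

  algorithm-depth : LoopDepth algorithm 3
  algorithm-depth =
    while (storeIndex ⨾ storeIndex ⨾ storeIndex ⨾ storeWeight ⨾
      while (storeIndex ⨾ storeWeight ⨾ if (short-loop-free (suc K))
        (storeIndex ⨾ storeWeight ⨾ while (storeIndex ⨾ if storeWeight skip) ⨾ storeWeight))) ⨾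
    storeWeight

  -- Correctness of the dynamic program

  module Correctness (R : Carrier) (1≤R : 1# ≤ R) (n : ℕ)
    (wt : ℕ → Carrier) (1≤wt : ∀ k → 1# ≤ wt k) (wt≤R : ∀ k → wt k ≤ R) where
    open WeightedKeys F
    open Intervals F
    open Optima R 1≤R wt 1≤wt wt≤R
    open Halting n
    open State

    addr : ℕ → ℕ → ℕ
    addr i j = j ℕ.* suc n ℕ.+ i

    addr-< : ∀ {i s j} i′ → s ℕ.< j → i ℕ.≤ n → addr i s ℕ.< addr i′ j
    addr-< {i} {s} {j} i′ s<j i≤n = begin-strict
      s ℕ.* suc n ℕ.+ i        <⟨ ℕ.+-monoʳ-< (s ℕ.* suc n) (ℕ.s≤s i≤n) ⟩
      s ℕ.* suc n ℕ.+ suc n    ≡⟨ ℕ.+-comm (s ℕ.* suc n) (suc n) ⟩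
      suc s ℕ.* suc n          ≤⟨ ℕ.*-monoˡ-≤ (suc n) s<j ⟩
      j ℕ.* suc n              ≤⟨ ℕ.m≤m+n (j ℕ.* suc n) i′ ⟩
      addr i′ j                ∎
      where open ℕ.≤-Reasoning

    addr-≢ : ∀ {i i′} j → i ≢ i′ → addr i j ≢ addr i′ j
    addr-≢ j i≢i′ eq = i≢i′ (ℕ.+-cancelˡ-≡ (j ℕ.* suc n) _ _ eq)

    record Registers (j i : ℕ) (m : ℕ → ℕ) : Set where
      field
        size  : m 0 ≡ n
        right : m 1 ≡ j
        left  : m 2 ≡ i
        rows  : ∀ {s} → s ℕ.≤ j → m (4 ℕ.+ s) ≡ s ℕ.* suc n
    open Registers

    eval-cell : ∀ {j k m i s} {d e : IndexExp} → Registers j k m →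
      evalIndex m d ≡ i → evalIndex m e ≡ s → s ℕ.≤ j → evalIndex m (cell d e) ≡ addr i s
    eval-cell {m = m} regs d≡ e≡ s≤j =
      ≡.cong₂ ℕ._+_ (≡.trans (≡.cong (λ s → m (4 ℕ.+ s)) e≡) (rows regs s≤j)) d≡

    eval-target : ∀ {i j m} → Registers j i m → evalIndex m target ≡ addr i j
    eval-target regs = eval-cell {d = leftᴵ} {rightᴵ} regs (left regs) (right regs) ℕ.≤-refl

    eval-total : ∀ {i j m} → Registers j i m → evalIndex m totalCell ≡ addr j j
    eval-total regs = eval-cell {d = rightᴵ} {rightᴵ} regs (right regs) (right regs) ℕ.≤-refl

    Input : (ℕ → Carrier) → Set c
    Input ws = ∀ {a} → a ℕ.< n → ws a ≡ wt a

    -- The order of computation: right ends ascending and, for equal right ends, left ends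
    -- descending.
    Before : ℕ → ℕ → ℕ → ℕ → Set
    Before i j i′ s = s ℕ.< j ⊎ (s ≡ j × i ℕ.≤ i′)

    Known : ℕ → ℕ → (ℕ → Carrier) → Set (c ⊔ ℓ₁ ⊔ ℓ₂)
    Known i j ws = ∀ {i′ s} → i′ ℕ.< s → Before i j i′ s → Best i′ s (ws (addr i′ s))

    Known-update : ∀ {i j x v} ws → (∀ {i′ s} → i′ ℕ.< s → Before i j i′ s → addr i′ s ≢ x) →
      Known i j ws → Known i j (ws [ x ≔ v ])
    Known-update ws ≢x known i′<s before =
      ≡.subst (Best _ _) (≡.sym (update-other ws (≢x i′<s before))) (known i′<s before)

    -- Row 0 of the table belongs to the empty intervals with right end 0 and is free for the input
    -- weights; every table entry written lies in a later row.
    Input-update : ∀ {i j ws v} → 1 ℕ.≤ j → Input ws → Input (ws [ addr i j ≔ v ])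
    Input-update {i} {ws = ws} 1≤j input {a} a<n =
      ≡.trans (update-other ws (ℕ.<⇒≢ (addr-< {a} {0} i 1≤j (ℕ.<⇒≤ a<n)))) (input a<n)

    Known-update-total : ∀ {i j v} ws → j ℕ.≤ n → Known i j ws → Known i j (ws [ addr j j ≔ v ])
    Known-update-total {j = j} ws j≤n = Known-update ws λ where
      i′<s (inj₁ s<j)         → ℕ.<⇒≢ (addr-< j s<j (ℕ.≤-trans (ℕ.<⇒≤ i′<s) (ℕ.≤-trans (ℕ.<⇒≤ s<j) j≤n)))
      i′<j (inj₂ (≡.refl , _)) → addr-≢ j (ℕ.<⇒≢ i′<j)

    Known-update-target : ∀ {i j v} ws → j ℕ.≤ n → Known (suc i) j ws → Known (suc i) j (ws [ addr i j ≔ v ])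
    Known-update-target {i} {j} ws j≤n = Known-update ws λ where
      i′<s (inj₁ s<j)            → ℕ.<⇒≢ (addr-< i s<j (ℕ.≤-trans (ℕ.<⇒≤ i′<s) (ℕ.≤-trans (ℕ.<⇒≤ s<j) j≤n)))
      _    (inj₂ (≡.refl , i<i′)) → addr-≢ j (ℕ.<⇒≢ i<i′ ∘ ≡.sym)

    Known-extend : ∀ {i j} ws → Best i j (ws (addr i j)) → Known (suc i) j ws → Known i j ws
    Known-extend ws best known i′<s (inj₁ s<j) = known i′<s (inj₁ s<j)
    Known-extend ws best known i′<s (inj₂ (≡.refl , i≤i′)) with ℕ.m≤n⇒m<n∨m≡n i≤i′
    ... | inj₁ i<i′   = known i′<s (inj₂ (≡.refl , i<i′))
    ... | inj₂ ≡.refl = best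

    -- The invariant of the loop over left ends: i is the last left end treated for j.
    record Progress (j i : ℕ) (σ : State Carrier) : Set (c ⊔ ℓ₁ ⊔ ℓ₂) where
      field
        regs  : Registers j i (indices σ)
        input : Input (weights σ)
        known : Known i j (weights σ)
        total≈ : weights σ (addr j j) ≈ total wt (interval i j)

    length-keyWeights : ∀ o l → length (keyWeights o l) ≡ l
    length-keyWeights o zero    = ≡.refl
    length-keyWeights o (suc l) = ≡.cong suc (length-keyWeights (suc o) l)

    eval-keyWeights : ∀ {i m ws} → m 2 ≡ i → Input ws → ∀ o l → i ℕ.+ o ℕ.+ l ℕ.≤ n →
      map (evalWeight F (state m ws)) (keyWeights o l) ≡ map wt (range (i ℕ.+ o) l)
    eval-keyWeights left≡ input o zero    _ = ≡.refl
    eval-keyWeights {i} {m} {ws} left≡ input o (suc l) bound = ≡.cong₂ _∷_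
      (≡.trans (≡.cong (λ i → ws (i ℕ.+ o)) left≡) (input (ℕ.≤-trans (ℕ.m<m+n (i ℕ.+ o) ℕ.z<s) bound)))
      (≡.subst (λ k → map (evalWeight F (state m ws)) (keyWeights (suc o) l) ≡ map wt (range k l)) (ℕ.+-suc i o)
        (eval-keyWeights left≡ input (suc o) l
          (ℕ.≤-trans (ℕ.≤-reflexive (≡.trans (≡.cong (ℕ._+ l) (ℕ.+-suc i o)) (≡.sym (ℕ.+-suc (i ℕ.+ o) l)))) bound)))

    short-halts : ∀ {q} {Q : State Carrier → Set q} {i j m ws} k → i ℕ.< j → j ℕ.≤ n → j ℕ.∸ i ℕ.≤ k →
      Registers j i m → Input ws →
      (∀ {v} → Best i j v → Q (state m (ws [ addr i j ≔ v ]))) →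
      Halts (short k) (state m ws) Q
    short-halts zero i<j _ len≤ _ _ _ = ⊥-elim (ℕ.<⇒≱ (ℕ.m<n⇒0<n∸m i<j) len≤)
    short-halts {i = i} {j} {m} {ws} (suc k) i<j j≤n len≤ regs input post =
      halts-if-≤ᴵ (j ℕ.∸ i) k (≡.cong₂ ℕ._∸_ (right regs) (left regs)) ≡.refl
        (λ len≤k → short-halts k i<j j≤n len≤k regs input post)
        (λ k<len → minimise-halts (addr i j) (suc k) (keyWeights 0 (suc k)) (eval-target regs) (λ ())
          (ℕ.≤-reflexive (length-keyWeights 0 (suc k)))
          (λ opt → post (IsOptimal-transport (keys (ℕ.≤-antisym len≤ k<len)) opt)))
      where
      keys : j ℕ.∸ i ≡ suc k →
        map (evalWeight F (state m ws)) (keyWeights 0 (suc k)) ≡ map wt (interval i j)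
      keys len≡ rewrite len≡ = ≡.trans
        (eval-keyWeights (left regs) input 0 (suc k) (ℕ.≤-trans (ℕ.≤-reflexive end) j≤n))
        (≡.cong (λ i → map wt (range i (suc k))) (ℕ.+-identityʳ i))
        where
        end : i ℕ.+ 0 ℕ.+ suc k ≡ j
        end = ≡.trans (≡.cong₂ ℕ._+_ (ℕ.+-identityʳ i) (≡.sym len≡)) (ℕ.m+[n∸m]≡n (ℕ.<⇒≤ i<j))

    -- Cell 3 differs by computation from cells 0, 1, 2 and `4 + s`, so the old proofs are reused as
    -- they stand.
    Registers-cut : ∀ {i j m x} → Registers j i m → Registers j i (m [ 3 ≔ x ])
    Registers-cut regs = record { size = size regs ; right = right regs ; left = left regs ; rows = rows regs }

    eval-cutCost : ∀ {i j s m} ws → Registers j i m → m 3 ≡ s → s ℕ.≤ j →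
      evalWeight F (state m ws) cutCost ≡ ws (addr i s) + ws (addr s j)
    eval-cutCost ws regs cut≡ s≤j = ≡.cong₂ _+_
      (≡.cong ws (eval-cell {d = leftᴵ} {cutᴵ} regs (left regs) cut≡ s≤j))
      (≡.cong ws (eval-cell {d = cutᴵ} {rightᴵ} regs cut≡ (right regs) ℕ.≤-refl))

    -- k cuts of [i , j) are still to be considered.
    record CutProgress (i j k : ℕ) (σ : State Carrier) : Set (c ⊔ ℓ₁ ⊔ ℓ₂) where
      field
        {cut}  : ℕ
        end    : suc cut ℕ.+ k ≡ j
        i<cut  : i ℕ.< cut
        regs   : Registers j i (indices σ)
        cut≡   : indices σ 3 ≡ cut
        input  : Input (weights σ)
        known  : Known (suc i) j (weights σ)
        total≈ : weights σ (addr j j) ≈ total wt (interval i j)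
        best   : BestCut i j cut (weights σ (addr i j))

    nextCut-halts : ∀ {i j k σ} → j ℕ.≤ n → CutProgress i j (suc k) σ →
      evalCondition F σ ((cutᴵ +ᴵ const 2) ≤ᴵ rightᴵ) ≡ true × Halts nextCut σ (CutProgress i j k)
    nextCut-halts {i} {j} {k} {state m ws} j≤n P =
      dec-true (m 3 ℕ.+ 2 ℕ.≤? m 1)
        (≡.subst₂ ℕ._≤_ (≡.trans (ℕ.+-comm 2 cut) (≡.cong (ℕ._+ 2) (≡.sym cut≡))) (≡.sym (right regs)) s<j) ,
      halts-seq (halts-storeIndex 3 s ≡.refl (≡.trans (≡.cong (ℕ._+ 1) cut≡) (ℕ.+-comm cut 1))
        (halts-if-≤ᵂ (p + q) (ws (addr i j)) (eval-cutCost ws regs′ ≡.refl s≤j) (≡.cong ws (eval-target regs′))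
          (λ better → halts-storeWeight (addr i j) (p + q) (eval-target regs′) (eval-cutCost ws regs′ ≡.refl s≤j) (record
            { end = end′ ; i<cut = i<s ; regs = regs′ ; cut≡ = ≡.refl
            ; input = Input-update 1≤j input
            ; known = Known-update-target ws j≤n known
            ; total≈ = trans (reflexive (update-other ws (addr-≢ j (ℕ.<⇒≢ i<j ∘ ≡.sym)))) total≈
            ; best = ≡.subst (BestCut i j s) (≡.sym (update-same ws (addr i j)))
                (BestCut-better (ℕ.<⇒≤ i<cut) best-left best-right best better)
            }))
          (λ worse → halts-skip (record
            { end = end′ ; i<cut = i<s ; regs = regs′ ; cut≡ = ≡.refl
            ; input = input ; known = known ; total≈ = total≈
            ; best = BestCut-worse best-left best-right best worse
            }))))
      where
      open CutProgress P
      s = suc cut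
      p = ws (addr i s)
      q = ws (addr s j)
      end′ : suc s ℕ.+ k ≡ j
      end′ = ≡.trans (≡.sym (ℕ.+-suc s k)) end
      s<j : s ℕ.< j
      s<j = ℕ.≤-trans (ℕ.m≤m+n (suc s) k) (ℕ.≤-reflexive end′)
      s≤j = ℕ.<⇒≤ s<j
      i<s : i ℕ.< s
      i<s = ℕ.m≤n⇒m≤1+n i<cut
      i<j = ℕ.<-trans i<s s<j
      1≤j : 1 ℕ.≤ j
      1≤j = ℕ.≤-trans (ℕ.s≤s ℕ.z≤n) s<j
      regs′ : Registers j i (m [ 3 ≔ s ])
      regs′ = Registers-cut regs
      best-left : Best i s p
      best-left = known i<s (inj₁ s<j)
      best-right : Best s j q
      best-right = known s<j (inj₂ (≡.refl , i<s))

    no-more-cuts : ∀ {i j σ} → CutProgress i j 0 σ → evalCondition F σ ((cutᴵ +ᴵ const 2) ≤ᴵ rightᴵ) ≡ false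
    no-more-cuts {σ = state m ws} P = dec-false (m 3 ℕ.+ 2 ℕ.≤? m 1) λ h → ℕ.<⇒≱ ℕ.≤-refl
      (≡.subst₂ ℕ._≤_ (≡.trans (≡.cong (ℕ._+ 2) (CutProgress.cut≡ P)) (ℕ.+-comm _ 2))
        (≡.trans (right (CutProgress.regs P)) (≡.trans (≡.sym (CutProgress.end P)) (ℕ.+-identityʳ _))) h)

    interval-∷ : ∀ {i j} → i ℕ.< j → interval i j ≡ i ∷ interval (suc i) j
    interval-∷ {i} i<j = ≡.cong (range i) (ℕ.+-∸-assoc 1 i<j)

    module _ (9R≤K : thrice (thrice R) ≤ K · 1#) where

      store-optimum-halts : ∀ {i j σ} → suc K ℕ.< j ℕ.∸ i → j ℕ.≤ n → CutProgress i j 0 σ →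
        Halts (storeWeight target (load totalCell +ᵂ load target)) σ (Progress j i)
      store-optimum-halts {i} {j} {state m ws} K<len j≤n P = halts-storeWeight (addr i j) v (eval-target regs)
        (≡.cong₂ _+_ (≡.cong ws (eval-total regs)) (≡.cong ws (eval-target regs))) (record
          { regs = regs
          ; input = Input-update 1≤j input
          ; known = Known-extend (ws [ addr i j ≔ v ]) (≡.subst (Best i j) (≡.sym (update-same ws (addr i j))) optimal)
              (Known-update-target ws j≤n known)
          ; total≈ = trans (reflexive (update-other ws (addr-≢ j (ℕ.<⇒≢ i<j ∘ ≡.sym)))) total≈
          })
        where
        open CutProgress P
        s<j : cut ℕ.< j
        s<j = ℕ.≤-reflexive (≡.trans (≡.sym (ℕ.+-identityʳ _)) end)
        i<j = ℕ.<-trans i<cut s<j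
        1≤j : 1 ℕ.≤ j
        1≤j = ℕ.≤-trans (ℕ.s≤s ℕ.z≤n) s<j
        v = ws (addr j j) + ws (addr i j)
        -- The right end is generalised so that it can be identified with `suc cut`, the form that
        -- `BestCut⇒Best` expects.
        optimal′ : ∀ {j} → suc cut ≡ j → suc K ℕ.< j ℕ.∸ i → Known (suc i) j ws →
          ∀ {b} → BestCut i j cut b → Best i j (total wt (interval i j) + b)
        optimal′ ≡.refl K<len known′ best′ = BestCut⇒Best {K = K} 9R≤K (ℕ.<⇒≤ (ℕ.<-trans ℕ.≤-refl K<len))
          (λ i<s s≤t → (_ , known′ i<s (inj₁ (ℕ.s≤s s≤t))) , (_ , known′ (ℕ.s≤s s≤t) (inj₂ (≡.refl , i<s)))) best′
        optimal : Best i j v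
        optimal = IsOptimal-resp-≈ (+-congʳ (sym total≈))
          (optimal′ (≡.trans (≡.sym (ℕ.+-identityʳ _)) end) K<len known best)

      long-halts : ∀ {i j m ws} → suc K ℕ.< j ℕ.∸ i → j ℕ.≤ n → Registers j i m → Input ws →
        Known (suc i) j ws → ws (addr j j) ≈ total wt (interval i j) →
        Halts long (state m ws) (Progress j i)
      long-halts {i} {j} {m} {ws} K<len j≤n regs input known total≈ =
        halts-seq (halts-storeIndex 3 s ≡.refl (≡.trans (≡.cong (ℕ._+ 1) (left regs)) (ℕ.+-comm i 1))
        (halts-seq (halts-storeWeight (addr i j) (p + q) (eval-target regs′) (eval-cutCost ws regs′ ≡.refl s≤j)
        (halts-seq (halts-map (store-optimum-halts K<len j≤n)
          (halts-while (CutProgress i j) (nextCut-halts j≤n) no-more-cuts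
            (ℕ.≤-trans (ℕ.m∸n≤m j (suc s)) j≤n)
            (record
            { end = ℕ.m+[n∸m]≡n s<j ; i<cut = ℕ.≤-refl ; regs = regs′ ; cut≡ = ≡.refl
            ; input = Input-update 1≤j input
            ; known = Known-update-target ws j≤n known
            ; total≈ = trans (reflexive (update-other ws (addr-≢ j (ℕ.<⇒≢ i<j ∘ ≡.sym)))) total≈
            ; best = ≡.subst (BestCut i j s) (≡.sym (update-same ws (addr i j)))
                (BestCut-first (known ℕ.≤-refl (inj₁ s<j)) (known s<j (inj₂ (≡.refl , ℕ.≤-refl))))
            })))))))
        where
        s = suc i
        p = ws (addr i s)
        q = ws (addr s j)
        s<j : s ℕ.< j
        s<j = ℕ.m≤o∸n⇒m+n≤o 2 (ℕ.<⇒≤ (ℕ.m∸n≢0⇒n<m λ len≡0 → ℕ.n≮0 (≡.subst (suc K ℕ.<_) len≡0 K<len)))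
          (ℕ.≤-trans (ℕ.s≤s (ℕ.s≤s ℕ.z≤n)) K<len)
        s≤j = ℕ.<⇒≤ s<j
        i<j = ℕ.<-trans ℕ.≤-refl s<j
        1≤j : 1 ℕ.≤ j
        1≤j = ℕ.≤-trans (ℕ.s≤s ℕ.z≤n) s<j
        regs′ : Registers j i (m [ 3 ≔ s ])
        regs′ = Registers-cut regs

      nextLeft-halts : ∀ {i j σ} → j ℕ.≤ n → Progress j (suc i) σ × suc i ℕ.≤ j →
        evalCondition F σ (const 1 ≤ᴵ leftᴵ) ≡ true × Halts nextLeft σ (λ τ → Progress j i τ × i ℕ.≤ j)
      nextLeft-halts {i} {j} {state m ws} j≤n (P , i<j) =
        dec-true (1 ℕ.≤? m 2) (≡.subst (1 ℕ.≤_) (≡.sym (left regs)) (ℕ.s≤s ℕ.z≤n)) ,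
        halts-seq (halts-storeIndex 2 i ≡.refl (≡.cong (ℕ._∸ 1) (left regs))
        (halts-seq (halts-storeWeight (addr j j) (wt i + ws (addr j j)) (eval-total regs′)
          (≡.cong₂ _+_ (input (ℕ.<-≤-trans i<j j≤n)) (≡.cong ws (eval-total regs′)))
        (halts-if-≤ᴵ (j ℕ.∸ i) (suc K) (≡.cong (ℕ._∸ i) (right regs)) ≡.refl
          (λ len≤K → short-halts (suc K) i<j j≤n len≤K regs′ input′ λ {v} best →
            record
              { regs = regs′
              ; input = Input-update 1≤j input′
              ; known = Known-extend (ws′ [ addr i j ≔ v ]) (≡.subst (Best i j) (≡.sym (update-same ws′ (addr i j))) best)
                  (Known-update-target ws′ j≤n known′)
              ; total≈ = trans (reflexive (update-other ws′ (addr-≢ j (ℕ.<⇒≢ i<j ∘ ≡.sym)))) total≈′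
              } , ℕ.<⇒≤ i<j)
          (λ K<len → halts-map (_, ℕ.<⇒≤ i<j)
            (long-halts K<len j≤n regs′ input′ known′ total≈′))))))
        where
        open Progress P
        1≤j : 1 ℕ.≤ j
        1≤j = ℕ.≤-trans (ℕ.s≤s ℕ.z≤n) i<j
        regs′ : Registers j i (m [ 2 ≔ i ])
        regs′ = record { size = size regs ; right = right regs ; left = ≡.refl ; rows = rows regs }
        ws′ = ws [ addr j j ≔ wt i + ws (addr j j) ]
        input′ : Input ws′
        input′ = Input-update 1≤j input
        known′ : Known (suc i) j ws′
        known′ = Known-update-total ws j≤n known
        total≈′ : ws′ (addr j j) ≈ total wt (interval i j)
        total≈′ = trans (reflexive (update-same ws (addr j j)))
          (trans (+-congˡ total≈) (reflexive (≡.cong (total wt) (≡.sym (interval-∷ i<j)))))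

      -- All intervals with right end at most n - k have been solved.
      record RightProgress (k : ℕ) (σ : State Carrier) : Set (c ⊔ ℓ₁ ⊔ ℓ₂) where
        field
          {right-end} : ℕ
          end    : right-end ℕ.+ k ≡ n
          regs   : Registers right-end 0 (indices σ)
          input  : Input (weights σ)
          known  : Known (suc right-end) (suc right-end) (weights σ)

      nextRight-halts : ∀ {k σ} → RightProgress (suc k) σ →
        evalCondition F σ ((rightᴵ +ᴵ const 1) ≤ᴵ sizeᴵ) ≡ true × Halts nextRight σ (RightProgress k)
      nextRight-halts {k} {state m ws} P =
        dec-true (m 1 ℕ.+ 1 ℕ.≤? m 0)
          (≡.subst₂ ℕ._≤_ (≡.sym right+1) (≡.sym (size regs)) j≤n) ,
        halts-seq (halts-storeIndex (5 ℕ.+ right-end) (j ℕ.* suc n) (≡.cong (5 ℕ.+_) (right regs)) next-row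
        (halts-seq (halts-storeIndex 1 j ≡.refl right+1
        (halts-seq (halts-storeIndex 2 j ≡.refl ≡.refl
        (halts-seq (halts-storeWeight (addr j j) 0# (eval-total regs′) ≡.refl
        (halts-map finish (halts-while (λ i τ → Progress j i τ × i ℕ.≤ j) (nextLeft-halts j≤n) stop j≤n
          (record
            { regs = regs′
            ; input = Input-update {j} {j} (ℕ.s≤s ℕ.z≤n) input
            ; known = Known-update-total ws j≤n known
            ; total≈ = reflexive (≡.trans (update-same ws (addr j j)) (≡.cong (λ l → total wt (range j l)) (≡.sym (ℕ.n∸n≡0 j))))
            } , ℕ.≤-refl))))))))))
        where
        open RightProgress P
        j = suc right-end
        end′ : j ℕ.+ k ≡ n
        end′ = ≡.trans (≡.sym (ℕ.+-suc right-end k)) end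
        j≤n : j ℕ.≤ n
        j≤n = ℕ.≤-trans (ℕ.m≤m+n j k) (ℕ.≤-reflexive end′)
        right+1 : m 1 ℕ.+ 1 ≡ j
        right+1 = ≡.trans (≡.cong (ℕ._+ 1) (right regs)) (ℕ.+-comm right-end 1)
        next-row : m (4 ℕ.+ m 1) ℕ.+ (m 0 ℕ.+ 1) ≡ j ℕ.* suc n
        next-row = ≡.trans
          (≡.cong₂ ℕ._+_ (≡.trans (≡.cong (λ s → m (4 ℕ.+ s)) (right regs)) (rows regs {right-end} ℕ.≤-refl))
            (≡.trans (≡.cong (ℕ._+ 1) (size regs)) (ℕ.+-comm n 1)))
          (ℕ.+-comm (right-end ℕ.* suc n) (suc n))
        m₁ = m [ 5 ℕ.+ right-end ≔ j ℕ.* suc n ]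
        rows′ : ∀ {s} → s ℕ.≤ j → m₁ (4 ℕ.+ s) ≡ s ℕ.* suc n
        rows′ s≤j with ℕ.m≤n⇒m<n∨m≡n s≤j
        ... | inj₁ (ℕ.s≤s s≤) = ≡.trans (update-other m (ℕ.<⇒≢ (ℕ.s≤s (ℕ.+-monoʳ-≤ 4 s≤)))) (rows regs s≤)
        ... | inj₂ ≡.refl = update-same m (5 ℕ.+ right-end)
        regs′ : Registers j j ((m₁ [ 1 ≔ j ]) [ 2 ≔ j ])
        regs′ = record { size = size regs ; right = ≡.refl ; left = ≡.refl ; rows = rows′ }

        stop : ∀ {σ} → Progress j 0 σ × 0 ℕ.≤ j → evalCondition F σ (const 1 ≤ᴵ leftᴵ) ≡ false
        stop {state m ws} (P , _) = dec-false (1 ℕ.≤? m 2) λ 1≤ →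
          ℕ.n≮0 (≡.subst (1 ℕ.≤_) (left (Progress.regs P)) 1≤)

        finish : ∀ {τ} → Progress j 0 τ × 0 ℕ.≤ j → RightProgress k τ
        finish (P , _) = record
          { right-end = j
          ; end = end′
          ; regs = Progress.regs P
          ; input = Progress.input P
          -- This is already the invariant for right end `suc j` and left end `suc j`: its clause
          -- for intervals that end at `suc j` is vacuous, as these would have to be empty.
          ; known = λ where
              i<s (inj₁ (ℕ.s≤s s≤j)) → Progress.known P i<s (case ℕ.m≤n⇒m<n∨m≡n s≤j of λ where
                (inj₁ s<j) → inj₁ s<j
                (inj₂ s≡j) → inj₂ (s≡j , ℕ.z≤n))
              i<s (inj₂ (≡.refl , s≤i)) → ⊥-elim (ℕ.<⇒≱ i<s s≤i)
          }

      algorithm-halts : ∀ {m ws} → 1 ℕ.≤ n → m 0 ≡ n → m 1 ≡ 0 → m 2 ≡ 0 → m 4 ≡ 0 → Input ws →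
        Halts algorithm (state m ws) (λ τ → Best 0 n (output F τ))
      algorithm-halts 1≤n m0 m1 m2 m4 input = halts-seq (halts-map finish
        (halts-while RightProgress nextRight-halts stop ℕ.≤-refl (record
          { right-end = 0
          ; end = ≡.refl
          ; regs = record { size = m0 ; right = m1 ; left = m2 ; rows = λ { ℕ.z≤n → m4 } }
          ; input = input
          ; known = λ where
              () (inj₁ (ℕ.s≤s ℕ.z≤n))
              (ℕ.s≤s ℕ.z≤n) (inj₂ (≡.refl , ()))
          })))
        where
        stop : ∀ {σ} → RightProgress 0 σ → evalCondition F σ ((rightᴵ +ᴵ const 1) ≤ᴵ sizeᴵ) ≡ false
        stop {state m ws} P = dec-false (m 1 ℕ.+ 1 ℕ.≤? m 0) λ h → ℕ.<⇒≱ ℕ.≤-refl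
          (≡.subst₂ ℕ._≤_ (≡.trans (≡.cong (ℕ._+ 1) (right regs)) (ℕ.+-comm _ 1))
            (≡.trans (size regs) (≡.trans (≡.sym end) (ℕ.+-identityʳ _))) h)
          where open RightProgress P

        finish : ∀ {σ} → RightProgress 0 σ →
          Halts (storeWeight (const 0) (load (cell (const 0) sizeᴵ))) σ (λ τ → Best 0 n (output F τ))
        finish {state m ws} P = halts-storeWeight 0 (ws (addr 0 n)) ≡.refl
          (≡.cong ws (eval-cell {d = const 0} {sizeᴵ} regs ≡.refl (size regs) (ℕ.≤-reflexive (≡.sym end′))))
          (known 1≤n (inj₁ (ℕ.s≤s (ℕ.≤-reflexive (≡.sym end′)))))
          where
          open RightProgress P
          end′ : right-end ≡ n
          end′ = ≡.trans (≡.sym (ℕ.+-identityʳ right-end)) end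

map-range-tabulate : ∀ (f : ℕ → A) {m} (g : Fin m → A) i → (∀ k → f (i ℕ.+ Fin.toℕ k) ≡ g k) →
  map f (range i m) ≡ tabulate g
map-range-tabulate f {zero}  g i eq = ≡.refl
map-range-tabulate f {suc m} g i eq = ≡.cong₂ _∷_
  (≡.trans (≡.cong f (≡.sym (ℕ.+-identityʳ i))) (eq Fin.zero))
  (map-range-tabulate f (g ∘ Fin.suc) (suc i) λ k →
    ≡.trans (≡.cong f (≡.sym (ℕ.+-suc i (Fin.toℕ k)))) (eq (Fin.suc k)))

module _ {c ℓ₁ ℓ₂} (F : ArchimedeanOrderedField c ℓ₁ ℓ₂) {n : ℕ}
  (w : Fin n → ArchimedeanOrderedField.Carrier F) where
  open OrderedField F

  -- Unlike inputWeights, padded so that all weights are at least 1.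
  paddedWeights : ℕ → Carrier
  paddedWeights a with a ℕ.<? n
  ... | yes a<n = w (Fin.fromℕ< a<n)
  ... | no _    = 1#

  inputWeights≡paddedWeights : ∀ {a} → a ℕ.< n → inputWeights F w a ≡ paddedWeights a
  inputWeights≡paddedWeights {a} a<n with a ℕ.<? n
  ... | yes _   = ≡.refl
  ... | no a≮n = ⊥-elim (a≮n a<n)

  paddedWeights-toℕ : ∀ k → paddedWeights (Fin.toℕ k) ≡ w k
  paddedWeights-toℕ k with Fin.toℕ k ℕ.<? n
  ... | yes k<n = ≡.cong w (Fin.fromℕ<-toℕ k k<n)
  ... | no k≮n  = ⊥-elim (k≮n (Fin.toℕ<n k))

  paddedWeights-bounded : ∀ {R} → 1# ≤ R → (∀ k → 1# ≤ w k × w k ≤ R) → ∀ a → 1# ≤ paddedWeights a × paddedWeights a ≤ R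
  paddedWeights-bounded 1≤R bounded a with a ℕ.<? n
  ... | yes a<n = bounded (Fin.fromℕ< a<n)
  ... | no _    = ≤-refl , 1≤R

mainTheorem11 : ∀ {c ℓ₁ ℓ₂} (F : ArchimedeanOrderedField c ℓ₁ ℓ₂) →
    let open ArchimedeanOrderedField F in
    (R : Carrier) → 1# ≤ R →
    Σ[ P ∈ Program Carrier ] Σ[ C ∈ ℕ ]
    (∀ (n : ℕ) → 1 ℕ.≤ n →
    (w : Fin n → Carrier) → (∀ k → 1# ≤ w k × w k ≤ R) →
    ComputesOptimalCost F P w (C ℕ.* n ^ 3))
mainTheorem11 F R 1≤R = algorithm , factor polynomial , λ n 1≤n w bounded →
  let bounds  = paddedWeights-bounded F w 1≤R bounded
      open Correctness R 1≤R n (paddedWeights F w) (proj₁ ∘ bounds) (proj₂ ∘ bounds)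
      τ , t , run , t≤ , best = algorithm-halts 9R≤K 1≤n ≡.refl ≡.refl ≡.refl ≡.refl (inputWeights≡paddedWeights F w)
      keys = ≡.trans (map-range-tabulate (paddedWeights F w) w 0 (paddedWeights-toℕ F w))
               (≡.sym (map-tabulate (λ k → k) w))
  in τ , t , run , ℕ.≤-trans t≤ (bound polynomial n 1≤n) ,
     SearchTrees.IsOptimal⇒IsOptimalCost F w (λ k → ≤-trans 0≤1 (proj₁ (bounded k)))
       (IsOptimal-transport keys best)
  where
  open OrderedField F
  open Intervals F using (IsOptimal-transport)
  -- `K` depends on `R` only, so the program and the constant are fixed before `n` and the weights.
  K = proj₁ (archimedean (thrice (thrice R)))
  9R≤K = proj₂ (archimedean (thrice (thrice R)))
  open Algorithm F K
  open Machine F using (module O; timeBound-polynomial)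
  open O
  polynomial = timeBound-polynomial algorithm-depth
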